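{- Let $m(d)$ denote the maximum number of vertices of the projection polytope ${\rm conv}(WS)={\rm conv}\{Wx : x\in S\}$ over all $n$, all matroids $S\subset\{0,1\}^n$ and all $\{0,1\}$-valued $d\times n$ matrices $W$. Then $$d2^d\ \le\ m(d)\ \le\ 2\sum_{k=0}^{d-1}\binom{\tfrac12(3^d-3)}{k}\ =\ O\left(3^{d(d-1)}\right).$$ For $d\le 2$ the lower and upper bounds coincide, and $m(1)=2$ and $m(2)=8$.
   Context: A set $S\subset\{0,1\}^n$ is called a matroid if it is the set of indicator vectors of the bases of a matroid on the ground set $\{1,\dots,n\}$. -}

module Defs where

open import Data.Nat using (ℕ; zero; suc; _^_; _∸_) renaming (_+_ to _+ℕ_; _*_ to _*ℕ_; _≤_ to _≤ℕ_)
open import Data.Nat.DivMod using (_/_)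
open import Data.Nat.Combinatorics using (_C_)
open import Data.Bool using (Bool; true; false; _∧_)
open import Data.Fin using (Fin)
open import Data.Vec using (Vec; lookup; _[_]≔_; tabulate) renaming (sum to vsum)
open import Data.List using (List; length; map; foldr; upTo)
open import Data.Nat.ListAction using (sum)
open import Data.List.Relation.Unary.All using (All)
open import Data.List.Relation.Unary.AllPairs using (AllPairs)
open import Data.Integer using (+_)
open import Data.Rational using (ℚ; 0ℚ; 1ℚ; _≤_; _*_; _+_) renaming (_/_ to _/ℚ_)
open import Data.Product using (Σ; ∃; _×_; _,_; proj₁; proj₂)
open import Relation.Binary.PropositionalEquality using (_≡_)
open import Relation.Nullary using (¬_)

-- A point of ℤ^d with nonnegative coordinates (all points W x lie in ℕ^d).
Point : ℕ → Set
Point d = Fin d → ℕ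

_≐_ : ∀ {d} → Point d → Point d → Set
p ≐ q = ∀ i → p i ≡ q i

-- A set S ⊆ {0,1}^n given by its (decidable) membership predicate.
-- S is a matroid: the set of indicator vectors of the bases of a matroid,
-- i.e. nonempty and satisfying the basis exchange axiom.
IsMatroid : (n : ℕ) → (Vec Bool n → Bool) → Set
IsMatroid n S =
  (∃ λ B → S B ≡ true) ×
  (∀ B₁ B₂ → S B₁ ≡ true → S B₂ ≡ true →
     ∀ i → lookup B₁ i ≡ true → lookup B₂ i ≡ false →
     ∃ λ j → lookup B₂ j ≡ true × lookup B₁ j ≡ false ×
             S ((B₁ [ i ]≔ false) [ j ]≔ true) ≡ true)

bool→ℕ : Bool → ℕ
bool→ℕ true = 1
bool→ℕ false = 0

Matrix01 : ℕ → ℕ → Set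
Matrix01 d n = Fin d → Fin n → Bool

apply : ∀ {d n} → Matrix01 d n → Vec Bool n → Point d
apply W x i = vsum (tabulate λ j → bool→ℕ (W i j ∧ lookup x j))

InImage : ∀ {d n} → Matrix01 d n → (Vec Bool n → Bool) → Point d → Set
InImage W S p = ∃ λ x → S x ≡ true × (apply W x ≐ p)

ℕ→ℚ : ℕ → ℚ
ℕ→ℚ n = (+ n) /ℚ 1

sumℚ : List ℚ → ℚ
sumℚ = foldr _+_ 0ℚ

InConvHull : ∀ {d} → (Point d → Set) → Point d → Set
InConvHull {d} P p =
  ∃ λ (cs : List (ℚ × Point d)) →
    All (λ c → (0ℚ ≤ proj₁ c) × P (proj₂ c)) cs ×
    (sumℚ (map proj₁ cs) ≡ 1ℚ) ×
    (∀ i → sumℚ (map (λ c → proj₁ c * ℕ→ℚ (proj₂ c i)) cs) ≡ ℕ→ℚ (p i))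

IsVertex : ∀ {d n} → Matrix01 d n → (Vec Bool n → Bool) → Point d → Set
IsVertex W S p =
  InImage W S p × ¬ InConvHull (λ q → InImage W S q × ¬ (q ≐ p)) p

Distinct : ∀ {d} → Point d → Point d → Set
Distinct p q = ¬ (p ≐ q)

VerticesAtLeast : ∀ {d n} → Matrix01 d n → (Vec Bool n → Bool) → ℕ → Set
VerticesAtLeast {d} W S k =
  ∃ λ (vs : List (Point d)) →
    (length vs ≡ k) × All (IsVertex W S) vs × AllPairs Distinct vs

VerticesAtMost : ∀ {d n} → Matrix01 d n → (Vec Bool n → Bool) → ℕ → Set
VerticesAtMost {d} W S k =
  ∀ (vs : List (Point d)) → All (IsVertex W S) vs → AllPairs Distinct vs →
    length vs ≤ℕ k

MaxAtLeast : ℕ → ℕ → Set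
MaxAtLeast d k =
  ∃ λ n → ∃ λ (S : Vec Bool n → Bool) → ∃ λ (W : Matrix01 d n) →
    IsMatroid n S × VerticesAtLeast W S k

MaxAtMost : ℕ → ℕ → Set
MaxAtMost d k =
  ∀ n (S : Vec Bool n → Bool) (W : Matrix01 d n) →
    IsMatroid n S → VerticesAtMost W S k

upperBound : ℕ → ℕ
upperBound d = 2 *ℕ sum (map (λ k → ((3 ^ d ∸ 3) / 2) C k) (upTo d))

{-# OPTIONS --safe #-}

-- A linear functional c on ℚ^d weights the j-th element of the ground set by c · W^j, where W^j is the
-- j-th column of W, and a basis is optimal as soon as no single exchange improves it.  Hence the vertex
-- of conv(WS) exposed by c depends only on the signs of c on the differences W^j − W^i ∈ {−1,0,1}^d, that
-- is, for generic c, on the cell containing c of the central arrangement of the (3^d−1)/2 ternary vectors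
-- taken up to sign.  Cells are counted with the Sauer–Shelah lemma: d + 1 forms in dimension d are linearly
-- dependent and so do not realise all sign patterns.
--
-- For the lower bound, the zonotope spanned by all these ternary vectors is the projection of a partition
-- matroid with blocks of size two, and its vertices correspond to the cells.  The orthant of c together
-- with the coordinate of largest absolute value distinguishes d 2^d of them.
module Submission where

open import Defs
open import Algebra.Bundles using (CommutativeMonoid)
open import Data.Bool using (Bool; true; false; _∧_; _∨_; not; _xor_; if_then_else_)
import Data.Bool.Properties as Bool
open import Data.Fin using (Fin; zero; suc; punchIn; _≟_)
open import Data.Fin.Properties using (all?; any?; ¬∀⟶∃¬)
open import Data.Integer as ℤ using (ℤ; +_; -[1+_]; 0ℤ; 1ℤ; -1ℤ)
import Data.Integer.Properties as ℤ
open import Data.Integer.Tactic.RingSolver using (solve-∀)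
open import Data.List as List using (List; []; _∷_; length; map; upTo; _∷ʳ_; _++_; filter; allFin; cartesianProduct)
open import Data.List.Membership.Propositional using (_∈_)
open import Data.List.Membership.Propositional.Properties
  using (∈-map⁻; ∈-map⁺; ∈-++⁺ˡ; ∈-++⁺ʳ; ∈-++⁻; ∈-filter⁺; ∈-lookup)
open import Data.List.Properties using (length-map; length-++; length-tabulate; upTo-∷ʳ; map-++)
open import Data.List.Relation.Unary.All as All using (All; []; _∷_)
import Data.List.Relation.Unary.All.Properties as All
open import Data.List.Relation.Unary.AllPairs as AllPairs using (AllPairs; []; _∷_)
import Data.List.Relation.Unary.AllPairs.Properties as AllPairs
open import Data.List.Relation.Unary.Any as Any using (here; there)
open import Data.List.Relation.Unary.Any.Properties using (lookup-index)
open import Data.List.Relation.Unary.Unique.Propositional using (Unique)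
import Data.List.Relation.Unary.Unique.Propositional.Properties as Unique
open import Data.Nat using (ℕ; zero; suc; _+_; _*_; _^_; _∸_; _/_; _≤_; _<_; _≤?_; z≤n; s≤s)
open import Data.Nat.Combinatorics using (_C_; nCk+nC[k+1]≡[n+1]C[k+1]; k>n⇒nCk≡0)
open import Data.Nat.DivMod using (m*n/n≡m)
open import Data.Nat.Induction using (<-wellFounded)
open import Data.Nat.ListAction using () renaming (sum to listSum)
open import Data.Nat.ListAction.Properties using (sum-++)
import Data.Nat.Properties as ℕ
open import Data.Nat.Tactic.RingSolver using () renaming (solve-∀ to solveℕ-∀)
open import Data.Product using (∃; _×_; _,_; proj₁; proj₂)
open import Data.Rational as ℚ using (ℚ; 0ℚ; 1ℚ; toℚᵘ)
import Data.Rational.Properties as ℚ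
open import Data.Rational.Unnormalised as ℚᵘ using (mkℚᵘ)
import Data.Rational.Unnormalised.Properties as ℚᵘ
open import Data.Sum using (_⊎_; inj₁; inj₂)
open import Data.Vec as Vec using (Vec; []; _∷_; lookup; tabulate; _[_]≔_; replicate)
open import Data.Vec.Functional using (insertAt)
open import Data.Vec.Functional.Properties using (insertAt-lookup; insertAt-punchIn)
open import Data.Vec.Properties
  using (≡-dec; lookup∘tabulate; lookup-map; []≔-lookup; lookup∘update′; tabulate∘lookup; tabulate-cong;
         lookup-replicate; ∷-injectiveˡ; ∷-injectiveʳ)
open import Function using (_∘_; id)
open import Induction.WellFounded using (Acc; acc)
open import Relation.Binary.Definitions using (tri<; tri≈; tri>)
open import Relation.Binary.PropositionalEquality
open import Relation.Nullary using (¬_; Dec; yes; no; contradiction; does; ¬?; _×-dec_)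
open import Relation.Nullary.Decidable using (dec-true; dec-false)

open import Algebra.Properties.CommutativeSemigroup ℕ.+-commutativeSemigroup
  using () renaming (interchange to +-interchange)
open import Algebra.Properties.CommutativeSemigroup
  (CommutativeMonoid.commutativeSemigroup ℚ.+-0-commutativeMonoid)
  using () renaming (interchange to ℚ-interchange)
open import Algebra.Properties.Semiring.Sum ℤ.+-*-semiring
  using (sum; sum-cong-≗; ∑-distrib-+; *-distribˡ-sum; *-distribʳ-sum; sum-remove; ∑-comm; sum-replicate-zero)

-- A vertex is given only as an image point outside the hull of the other image points, so a
-- functional exposing it has to be produced. Gordan's alternative does this: if there is none, the
-- differences from the point to the others have a vanishing positive combination, which is a convex
-- representation of the point. All of this runs over ℤ: a small perturbation c + εu becomes N c +
-- u, and a positive combination becomes a list with repetitions, to be averaged with equal weights.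
--
-- Applied to all forms at once, Sauer-Shelah would give the sum over k ≤ d. But a linear relation
-- excludes a sign pattern together with its opposite, so a pattern is still excluded after the sign
-- of one form has been prescribed. This lowers the degree to d - 1, leaves (3^d - 3)/2 forms, and
-- costs a factor 2 for the two signs of the chosen form.
--
-- For the lower bound, the d 2^d functionals written down are in general not generic; they are
-- perturbed without losing any strict sign on a ternary vector.

-- Integer inequalities and finite sums

pos*pos : ∀ {a b} → 0ℤ ℤ.< a → 0ℤ ℤ.< b → 0ℤ ℤ.< a ℤ.* b
pos*pos (ℤ.+<+ (s≤s z≤n)) (ℤ.+<+ (s≤s z≤n)) = ℤ.+<+ (s≤s z≤n)

neg*neg : ∀ {a b} → a ℤ.< 0ℤ → b ℤ.< 0ℤ → 0ℤ ℤ.< a ℤ.* b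
neg*neg ℤ.-<+ ℤ.-<+ = ℤ.+<+ (s≤s z≤n)

square-pos : ∀ a → a ≢ 0ℤ → 0ℤ ℤ.< a ℤ.* a
square-pos (+ zero)  a≢0 = contradiction refl a≢0
square-pos (+ suc _) _   = ℤ.+<+ (s≤s z≤n)
square-pos -[1+ _ ]  _   = ℤ.+<+ (s≤s z≤n)

square-nonNeg : ∀ a → 0ℤ ℤ.≤ a ℤ.* a
square-nonNeg (+ zero)  = ℤ.≤-refl
square-nonNeg (+ suc _) = ℤ.+≤+ z≤n
square-nonNeg -[1+ _ ]  = ℤ.+≤+ z≤n

neg⇒0<- : ∀ {a} → a ℤ.< 0ℤ → 0ℤ ℤ.< ℤ.- a
neg⇒0<- ℤ.-<+ = ℤ.+<+ (s≤s z≤n)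

0<-⇒neg : ∀ {a} → 0ℤ ℤ.< ℤ.- a → a ℤ.< 0ℤ
0<-⇒neg { -[1+ _ ]} _ = ℤ.-<+
0<-⇒neg {+ zero} (ℤ.+<+ ())
0<-⇒neg {+ suc _} ()

0<j-i⇒i<j : ∀ {i j} → 0ℤ ℤ.< j ℤ.- i → i ℤ.< j
0<j-i⇒i<j {i} {j} 0<j-i = subst₂ ℤ._<_ (ℤ.+-identityˡ i) (cancel i j) (ℤ.+-monoˡ-< i 0<j-i)
  where
  cancel : ∀ i j → j ℤ.- i ℤ.+ i ≡ j
  cancel = solve-∀

i<j⇒0<j-i : ∀ {i j} → i ℤ.< j → 0ℤ ℤ.< j ℤ.- i
i<j⇒0<j-i {i} {j} i<j = subst (ℤ._< j ℤ.- i) (ℤ.+-inverseʳ i) (ℤ.+-monoˡ-< (ℤ.- i) i<j)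

sum-nonNeg : ∀ {n} (f : Fin n → ℤ) → (∀ i → 0ℤ ℤ.≤ f i) → 0ℤ ℤ.≤ sum f
sum-nonNeg {zero}  f f≥0 = ℤ.≤-refl
sum-nonNeg {suc n} f f≥0 = ℤ.+-mono-≤ (f≥0 zero) (sum-nonNeg (f ∘ suc) (f≥0 ∘ suc))

sum-pos : ∀ {n} (f : Fin n → ℤ) → (∀ i → 0ℤ ℤ.≤ f i) → ∀ i → 0ℤ ℤ.< f i → 0ℤ ℤ.< sum f
sum-pos f f≥0 zero    0<fi = ℤ.+-mono-<-≤ 0<fi (sum-nonNeg (f ∘ suc) (f≥0 ∘ suc))
sum-pos f f≥0 (suc i) 0<fi = ℤ.+-mono-≤-< (f≥0 zero) (sum-pos (f ∘ suc) (f≥0 ∘ suc) i 0<fi)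

sum-zero : ∀ {n} (f : Fin n → ℤ) → (∀ i → f i ≡ 0ℤ) → sum f ≡ 0ℤ
sum-zero {n} f f≡0 = trans (sum-cong-≗ f≡0) (sum-replicate-zero n)

-- Integer vectors and linear functionals

Vector : ℕ → Set
Vector d = Fin d → ℤ

IsZero : ∀ {d} → Vector d → Set
IsZero u = ∀ i → u i ≡ 0ℤ

lin : ∀ {d} → ℤ → Vector d → ℤ → Vector d → Vector d
lin a u b v i = a ℤ.* u i ℤ.+ b ℤ.* v i

neg : ∀ {d} → Vector d → Vector d
neg u i = ℤ.- u i

dot : ∀ {d} → Vector d → Vector d → ℤ
dot u v = sum (λ i → u i ℤ.* v i)

dot-congʳ : ∀ {d} (c : Vector d) {u v} → u ≗ v → dot c u ≡ dot c v
dot-congʳ c u≗v = sum-cong-≗ (λ i → cong (c i ℤ.*_) (u≗v i))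

dot-comm : ∀ {d} (u v : Vector d) → dot u v ≡ dot v u
dot-comm u v = sum-cong-≗ (λ i → ℤ.*-comm (u i) (v i))

dot-linʳ : ∀ {d} (c : Vector d) a u b v → dot c (lin a u b v) ≡ a ℤ.* dot c u ℤ.+ b ℤ.* dot c v
dot-linʳ c a u b v = begin
  dot c (lin a u b v)
    ≡⟨ sum-cong-≗ (λ i → distribute (c i) a (u i) b (v i)) ⟩
  sum (λ i → a ℤ.* (c i ℤ.* u i) ℤ.+ b ℤ.* (c i ℤ.* v i))
    ≡⟨ ∑-distrib-+ (λ i → a ℤ.* (c i ℤ.* u i)) (λ i → b ℤ.* (c i ℤ.* v i)) ⟩
  sum (λ i → a ℤ.* (c i ℤ.* u i)) ℤ.+ sum (λ i → b ℤ.* (c i ℤ.* v i))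
    ≡⟨ cong₂ ℤ._+_ (*-distribˡ-sum a (λ i → c i ℤ.* u i)) (*-distribˡ-sum b (λ i → c i ℤ.* v i)) ⟨
  a ℤ.* dot c u ℤ.+ b ℤ.* dot c v ∎
  where
  open ≡-Reasoning
  distribute : ∀ c a u b v → c ℤ.* (a ℤ.* u ℤ.+ b ℤ.* v) ≡ a ℤ.* (c ℤ.* u) ℤ.+ b ℤ.* (c ℤ.* v)
  distribute = solve-∀

dot-linˡ : ∀ {d} a (u : Vector d) b v c → dot (lin a u b v) c ≡ a ℤ.* dot u c ℤ.+ b ℤ.* dot v c
dot-linˡ a u b v c = begin
  dot (lin a u b v) c              ≡⟨ dot-comm (lin a u b v) c ⟩
  dot c (lin a u b v)              ≡⟨ dot-linʳ c a u b v ⟩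
  a ℤ.* dot c u ℤ.+ b ℤ.* dot c v  ≡⟨ cong₂ (λ x y → a ℤ.* x ℤ.+ b ℤ.* y) (dot-comm c u) (dot-comm c v) ⟩
  a ℤ.* dot u c ℤ.+ b ℤ.* dot v c  ∎
  where open ≡-Reasoning

dot-negʳ : ∀ {d} (c u : Vector d) → dot c (neg u) ≡ ℤ.- dot c u
dot-negʳ c u = begin
  dot c (neg u)                              ≡⟨ dot-congʳ c (λ i → as-lin (u i)) ⟩
  dot c (lin (ℤ.- 1ℤ) u 0ℤ u)                ≡⟨ dot-linʳ c (ℤ.- 1ℤ) u 0ℤ u ⟩
  ℤ.- 1ℤ ℤ.* dot c u ℤ.+ 0ℤ ℤ.* dot c u      ≡⟨ as-lin (dot c u) ⟨
  ℤ.- dot c u                                ∎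
  where
  open ≡-Reasoning
  as-lin : ∀ x → ℤ.- x ≡ ℤ.- 1ℤ ℤ.* x ℤ.+ 0ℤ ℤ.* x
  as-lin = solve-∀

dot-negˡ : ∀ {d} (c u : Vector d) → dot (neg c) u ≡ ℤ.- dot c u
dot-negˡ c u = trans (dot-comm (neg c) u) (trans (dot-negʳ u c) (cong ℤ.-_ (dot-comm u c)))

dot-+ʳ : ∀ {d} (c u v : Vector d) → dot c (λ i → u i ℤ.+ v i) ≡ dot c u ℤ.+ dot c v
dot-+ʳ c u v = begin
  dot c (λ i → u i ℤ.+ v i)             ≡⟨ dot-congʳ c (λ i → scaled (u i) (v i)) ⟩
  dot c (lin 1ℤ u 1ℤ v)                 ≡⟨ dot-linʳ c 1ℤ u 1ℤ v ⟩
  1ℤ ℤ.* dot c u ℤ.+ 1ℤ ℤ.* dot c v     ≡⟨ scaled (dot c u) (dot c v) ⟨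
  dot c u ℤ.+ dot c v                   ∎
  where
  open ≡-Reasoning
  scaled : ∀ x y → x ℤ.+ y ≡ 1ℤ ℤ.* x ℤ.+ 1ℤ ℤ.* y
  scaled = solve-∀

dot-−ʳ : ∀ {d} (c u v : Vector d) → dot c (λ i → u i ℤ.- v i) ≡ dot c u ℤ.- dot c v
dot-−ʳ c u v = trans (dot-+ʳ c u (neg v)) (cong (λ x → dot c u ℤ.+ x) (dot-negʳ c v))

dot-zeroʳ : ∀ {d} (c : Vector d) {u} → IsZero u → dot c u ≡ 0ℤ
dot-zeroʳ c u≡0 = sum-zero _ (λ i → trans (cong (c i ℤ.*_) (u≡0 i)) (ℤ.*-zeroʳ (c i)))

dot-self-pos : ∀ {d} (u : Vector d) → ¬ IsZero u → 0ℤ ℤ.< dot u u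
dot-self-pos u u≢0 with ¬∀⟶∃¬ _ _ (λ i → u i ℤ.≟ 0ℤ) u≢0
... | i , uᵢ≢0 = sum-pos _ (λ j → square-nonNeg (u j)) i (square-pos (u i) uᵢ≢0)

-- Perturbation and strict separation over ℤ

abs-dominates : ∀ a b → 0ℤ ℤ.< a → 0ℤ ℤ.< + suc ℤ.∣ b ∣ ℤ.* a ℤ.+ b
abs-dominates a b 0<a = ℤ.<-≤-trans (0<1+∣b∣+b b) (ℤ.+-monoˡ-≤ b 1+∣b∣≤)
  where
  0<1+∣b∣+b : ∀ b → 0ℤ ℤ.< + suc ℤ.∣ b ∣ ℤ.+ b
  0<1+∣b∣+b (+ n)     = ℤ.+<+ (s≤s z≤n)
  0<1+∣b∣+b -[1+ n ]  = subst (0ℤ ℤ.<_) (sym (1+x-x (+ suc n))) (ℤ.+<+ (s≤s z≤n))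
    where
    1+x-x : ∀ x → (1ℤ ℤ.+ x) ℤ.+ (ℤ.- x) ≡ 1ℤ
    1+x-x = solve-∀
  1+∣b∣≤ : + suc ℤ.∣ b ∣ ℤ.≤ + suc ℤ.∣ b ∣ ℤ.* a
  1+∣b∣≤ = ℤ.≤-trans (ℤ.≤-reflexive (sym (ℤ.*-identityʳ _)))
             (ℤ.*-monoˡ-≤-nonNeg (+ suc ℤ.∣ b ∣) (ℤ.i<j⇒suc[i]≤j 0<a))

-- One N serves the whole list because raising N keeps every inequality already won: the
-- coefficients concerned are positive.
archimedean : ∀ {A : Set} (a b : A → ℤ) (xs : List A) →
  ∃ λ N → All (λ x → 0ℤ ℤ.< a x → 0ℤ ℤ.< + N ℤ.* a x ℤ.+ b x) xs
archimedean a b []       = 0 , []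
archimedean a b (x ∷ xs) with archimedean a b xs
... | N , large = suc ℤ.∣ b x ∣ + N , first ∷ All.map later large
  where
  split : ∀ a b m n → (m ℤ.+ n) ℤ.* a ℤ.+ b ≡ (m ℤ.* a ℤ.+ b) ℤ.+ n ℤ.* a
  split = solve-∀
  split′ : ∀ a b m n → (m ℤ.+ n) ℤ.* a ℤ.+ b ≡ (n ℤ.* a ℤ.+ b) ℤ.+ m ℤ.* a
  split′ = solve-∀
  nonNeg*pos : ∀ n {a} → 0ℤ ℤ.< a → 0ℤ ℤ.≤ + n ℤ.* a
  nonNeg*pos zero    (ℤ.+<+ (s≤s z≤n)) = ℤ.+≤+ z≤n
  nonNeg*pos (suc n) (ℤ.+<+ (s≤s z≤n)) = ℤ.+≤+ z≤n
  first : 0ℤ ℤ.< a x → _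
  first 0<a = subst (0ℤ ℤ.<_) (sym (split (a x) (b x) (+ suc ℤ.∣ b x ∣) (+ N)))
    (ℤ.+-mono-<-≤ (abs-dominates (a x) (b x) 0<a) (nonNeg*pos N 0<a))
  later : ∀ {y} → (0ℤ ℤ.< a y → 0ℤ ℤ.< + N ℤ.* a y ℤ.+ b y) → 0ℤ ℤ.< a y → _
  later {y} h 0<a = subst (0ℤ ℤ.<_) (sym (split′ (a y) (b y) (+ suc ℤ.∣ b x ∣) (+ N)))
    (ℤ.+-mono-<-≤ (h 0<a) (nonNeg*pos (suc ℤ.∣ b x ∣) 0<a))

-- N c + u plays the part of c + εu: a step in direction `u` too small to destroy a strict
-- inequality of `c`.
nudge : ∀ {d} (c u : Vector d) (vs : List (Vector d)) →
  ∃ λ N → All (λ v → 0ℤ ℤ.< dot c v → 0ℤ ℤ.< dot (lin (+ N) c 1ℤ u) v) vs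
nudge c u vs with archimedean (dot c) (dot u) vs
... | N , large = N , All.map (λ {v} h 0<cv → subst (0ℤ ℤ.<_) (sym (expand v)) (h 0<cv)) large
  where
  expand : ∀ v → dot (lin (+ N) c 1ℤ u) v ≡ + N ℤ.* dot c v ℤ.+ dot u v
  expand v = trans (dot-linˡ (+ N) c 1ℤ u v) (cong (λ x → + N ℤ.* dot c v ℤ.+ x) (ℤ.*-identityˡ _))

nudge-self : ∀ {d} (c u : Vector d) N → dot c u ≡ 0ℤ → dot (lin (+ N) c 1ℤ u) u ≡ dot u u
nudge-self c u N cu≡0 = begin
  dot (lin (+ N) c 1ℤ u) u                ≡⟨ dot-linˡ (+ N) c 1ℤ u u ⟩
  + N ℤ.* dot c u ℤ.+ 1ℤ ℤ.* dot u u      ≡⟨ cong (λ x → + N ℤ.* x ℤ.+ 1ℤ ℤ.* dot u u) cu≡0 ⟩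
  + N ℤ.* 0ℤ ℤ.+ 1ℤ ℤ.* dot u u           ≡⟨ simplify (+ N) (dot u u) ⟩
  dot u u                                 ∎
  where
  open ≡-Reasoning
  simplify : ∀ n x → n ℤ.* 0ℤ ℤ.+ 1ℤ ℤ.* x ≡ x
  simplify = solve-∀

-- Hyperplanes are left one at a time. Adding `h` and `neg h` to the vectors whose positivity is
-- kept prevents later steps from returning to a hyperplane already left.
perturb : ∀ {d} (hs us : List (Vector d)) (c : Vector d) → ∃ λ c′ →
  All (λ u → 0ℤ ℤ.< dot c u → 0ℤ ℤ.< dot c′ u) us ×
  All (λ h → IsZero h ⊎ dot c′ h ≢ 0ℤ) hs
perturb [] us c = c , All.universal (λ _ → id) us , []
perturb {d} (h ∷ hs) us c = continue (off-hyperplane (dot c h ℤ.≟ 0ℤ) (all? (λ i → h i ℤ.≟ 0ℤ)))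
  where
  Goal : Vector d → Set
  Goal c₁ = All (λ u → 0ℤ ℤ.< dot c u → 0ℤ ℤ.< dot c₁ u) us × (IsZero h ⊎ dot c₁ h ≢ 0ℤ)

  off-hyperplane : Dec (dot c h ≡ 0ℤ) → Dec (IsZero h) → ∃ Goal
  off-hyperplane _ (yes h≡0) = c , All.universal (λ _ → id) us , inj₁ h≡0
  off-hyperplane (no ch≢0) (no _) = c , All.universal (λ _ → id) us , inj₂ ch≢0
  off-hyperplane (yes ch≡0) (no h≢0) with nudge c h us
  ... | N , preserved = lin (+ N) c 1ℤ h , preserved ,
    inj₂ (λ eq → ℤ.<-irrefl (trans (sym eq) (nudge-self c h N ch≡0)) (dot-self-pos h h≢0))

  continue : ∃ Goal → ∃ λ c′ →
    All (λ u → 0ℤ ℤ.< dot c u → 0ℤ ℤ.< dot c′ u) us ×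
    All (λ h → IsZero h ⊎ dot c′ h ≢ 0ℤ) (h ∷ hs)
  continue (c₁ , kept₁ , off₁) with perturb hs (h ∷ neg h ∷ us) c₁
  ... | c₂ , keepPos ∷ keepNeg ∷ kept₂ , off₂ =
    c₂ , All.zipWith (λ (f , g) → g ∘ f) (kept₁ , kept₂) , still off₁ ∷ off₂
    where
    still : IsZero h ⊎ dot c₁ h ≢ 0ℤ → IsZero h ⊎ dot c₂ h ≢ 0ℤ
    still (inj₁ h≡0) = inj₁ h≡0
    still (inj₂ c₁h≢0) with ℤ.<-cmp 0ℤ (dot c₁ h)
    ... | tri≈ _ eq _ = contradiction (sym eq) c₁h≢0
    ... | tri< 0<c₁h _ _ = inj₂ (ℤ.<⇒≢ (keepPos 0<c₁h) ∘ sym)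
    ... | tri> _ _ c₁h<0 = inj₂ (ℤ.<⇒≢ (0<-⇒neg (subst (0ℤ ℤ.<_) (dot-negʳ c₂ h)
                             (keepNeg (subst (0ℤ ℤ.<_) (sym (dot-negʳ c₁ h)) (neg⇒0<- c₁h<0))))))

-- `P` certifies membership in a cone. Closure under addition suffices, positive integer multiples
-- being repeated sums, and the caller interprets a vanishing element in its own terms.
module _ {d} (P : Vector d → Set)
         (resp : ∀ {u v} → u ≗ v → P u → P v)
         (add : ∀ {u v} → P u → P v → P (λ i → u i ℤ.+ v i)) where

  private
    scale : ∀ n {u} → P u → P (λ i → + suc n ℤ.* u i)
    scale zero    pu = resp (λ i → sym (ℤ.*-identityˡ _)) pu
    scale (suc n) pu = resp (λ i → step (+ suc n) _) (add pu (scale n pu))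
      where
      step : ∀ n x → x ℤ.+ n ℤ.* x ≡ (1ℤ ℤ.+ n) ℤ.* x
      step = solve-∀

    P-lin : ∀ {a b u v} → 0ℤ ℤ.< a → 0ℤ ℤ.< b → P u → P v → P (lin a u b v)
    P-lin {+ suc a} {+ suc b} (ℤ.+<+ (s≤s z≤n)) (ℤ.+<+ (s≤s z≤n)) pu pv = add (scale a pu) (scale b pv)

  -- Gordan's alternative.  If c is positive on us but negative on u, then pushing each v ∈ us along
  -- the segment [v , u] into the hyperplane c^⊥ gives a shorter list; a functional c′ positive on it
  -- is corrected by a multiple of c.
  gordan : ∀ n us → length us ≡ n → All P us →
    (∃ λ c → All (λ u → 0ℤ ℤ.< dot c u) us) ⊎ (∃ λ v → P v × IsZero v)
  gordan n [] _ _ = inj₁ ((λ _ → 0ℤ) , [])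
  gordan (suc n) (u ∷ us) len (pu ∷ pus) with gordan n us (ℕ.suc-injective len) pus
  ... | inj₂ r = inj₂ r
  ... | inj₁ (c , c>0) with ℤ.<-cmp 0ℤ (dot c u)
  ...   | tri< 0<cu _ _ = inj₁ (c , 0<cu ∷ c>0)
  -- Nudging `c` towards `u` itself makes it positive on `u`, since u · u > 0 unless u = 0; in that
  -- case `u` is the vanishing element.
  ...   | tri≈ _ 0≡cu _ with all? (λ i → u i ℤ.≟ 0ℤ)
  ...     | yes u≡0 = inj₂ (u , pu , u≡0)
  ...     | no  u≢0 with nudge c u us
  ...       | N , preserved = inj₁ (lin (+ N) c 1ℤ u , subst (0ℤ ℤ.<_) (sym (nudge-self c u N (sym 0≡cu))) (dot-self-pos u u≢0)
                                    ∷ All.zipWith (λ (f , x) → f x) (preserved , c>0))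
  gordan (suc n) (u ∷ us) len (pu ∷ pus) | inj₁ (c , c>0) | tri> _ _ cu<0 =
    finish (gordan n (map push us) (trans (length-map push us) (ℕ.suc-injective len))
             (All.map⁺ (All.zipWith (λ (0<cv , pv) → P-lin 0<cv 0<β pu pv) (c>0 , pus))))
    where
    β : ℤ
    β = ℤ.- dot c u
    0<β : 0ℤ ℤ.< β
    0<β = neg⇒0<- cu<0
    push : Vector d → Vector d
    push v = lin (dot c v) u β v

    finish : (∃ λ c′ → All (λ v → 0ℤ ℤ.< dot c′ v) (map push us)) ⊎ (∃ λ v → P v × IsZero v) → _
    finish (inj₂ r) = inj₂ r
    finish (inj₁ (c′ , c′>0)) with archimedean (dot c′ ∘ push) (λ v → ℤ.- dot c v) us
    ... | N , large = inj₁ (c″ , at-u ∷ All.zipWith (λ (f , x) → at-v f x) (large , All.map⁻ c′>0))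
      where
      -- N (β c′ + (c′ · u) c) vanishes at `u`, because β = - c · u, and equals N c′ · `push v` at
      -- `v`. Subtracting `c` makes the value at `u` equal to β > 0, and N is large enough to absorb
      -- the change at each `v`.
      γ δ : ℤ
      γ = + N ℤ.* β
      δ = + N ℤ.* dot c′ u ℤ.- 1ℤ
      c″ : Vector d
      c″ = lin γ c′ δ c
      identity-u : ∀ N x y → N ℤ.* (ℤ.- y) ℤ.* x ℤ.+ (N ℤ.* x ℤ.- 1ℤ) ℤ.* y ≡ ℤ.- y
      identity-u = solve-∀
      identity-v : ∀ N β x y z → N ℤ.* β ℤ.* y ℤ.+ (N ℤ.* x ℤ.- 1ℤ) ℤ.* z ≡ N ℤ.* (z ℤ.* x ℤ.+ β ℤ.* y) ℤ.- z
      identity-v = solve-∀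
      at-u : 0ℤ ℤ.< dot c″ u
      at-u = subst (0ℤ ℤ.<_) (sym (trans (dot-linˡ γ c′ δ c u) (identity-u (+ N) (dot c′ u) (dot c u)))) 0<β
      at-v : ∀ {v} → (0ℤ ℤ.< dot c′ (push v) → 0ℤ ℤ.< + N ℤ.* dot c′ (push v) ℤ.- dot c v) →
             0ℤ ℤ.< dot c′ (push v) → 0ℤ ℤ.< dot c″ v
      at-v {v} f x = subst (0ℤ ℤ.<_) (sym eq) (f x)
        where
        open ≡-Reasoning
        eq : dot c″ v ≡ + N ℤ.* dot c′ (push v) ℤ.- dot c v
        eq = begin
          dot c″ v
            ≡⟨ dot-linˡ γ c′ δ c v ⟩
          + N ℤ.* β ℤ.* dot c′ v ℤ.+ (+ N ℤ.* dot c′ u ℤ.- 1ℤ) ℤ.* dot c v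
            ≡⟨ identity-v (+ N) β (dot c′ u) (dot c′ v) (dot c v) ⟩
          + N ℤ.* (dot c v ℤ.* dot c′ u ℤ.+ β ℤ.* dot c′ v) ℤ.- dot c v
            ≡⟨ cong (λ x → + N ℤ.* x ℤ.- dot c v) (dot-linʳ c′ (dot c v) u β v) ⟨
          + N ℤ.* dot c′ (push v) ℤ.- dot c v ∎

-- Counting sign vectors

binomialSum : ℕ → ℕ → ℕ
binomialSum m d = listSum (map (m C_) (upTo d))

binomialSum-suc : ∀ m d → binomialSum m (suc d) ≡ binomialSum m d + m C d
binomialSum-suc m d = begin
  listSum (map (m C_) (upTo (suc d)))         ≡⟨ cong (listSum ∘ map (m C_)) (upTo-∷ʳ d) ⟨
  listSum (map (m C_) (upTo d ∷ʳ d))          ≡⟨ cong listSum (map-++ (m C_) (upTo d) (d ∷ [])) ⟩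
  listSum (map (m C_) (upTo d) ++ m C d ∷ []) ≡⟨ sum-++ (map (m C_) (upTo d)) _ ⟩
  binomialSum m d + (m C d + 0)               ≡⟨ cong (λ x → binomialSum m d + x) (ℕ.+-identityʳ _) ⟩
  binomialSum m d + m C d                     ∎
  where open ≡-Reasoning

binomialSum-zero : ∀ d → binomialSum 0 (suc d) ≡ 1
binomialSum-zero zero    = refl
binomialSum-zero (suc d) = begin
  binomialSum 0 (suc (suc d))        ≡⟨ binomialSum-suc 0 (suc d) ⟩
  binomialSum 0 (suc d) + 0 C suc d  ≡⟨ cong₂ _+_ (binomialSum-zero d) (k>n⇒nCk≡0 {0} {suc d} (s≤s z≤n)) ⟩
  1                                  ∎
  where open ≡-Reasoning

binomialSum-pascal : ∀ m d → binomialSum (suc m) (suc d) ≡ binomialSum m (suc d) + binomialSum m d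
binomialSum-pascal m zero    = refl
binomialSum-pascal m (suc d) = begin
  binomialSum (suc m) (2 + d)
    ≡⟨ binomialSum-suc (suc m) (suc d) ⟩
  binomialSum (suc m) (suc d) + suc m C suc d
    ≡⟨ cong₂ _+_ (binomialSum-pascal m d) (sym (nCk+nC[k+1]≡[n+1]C[k+1] m d)) ⟩
  (binomialSum m (suc d) + binomialSum m d) + (m C d + m C suc d)
    ≡⟨ cong (λ x → (binomialSum m (suc d) + binomialSum m d) + x) (ℕ.+-comm (m C d) _) ⟩
  (binomialSum m (suc d) + binomialSum m d) + (m C suc d + m C d)
    ≡⟨ +-interchange (binomialSum m (suc d)) (binomialSum m d) (m C suc d) (m C d) ⟩
  (binomialSum m (suc d) + m C suc d) + (binomialSum m d + m C d)
    ≡⟨ cong₂ _+_ (binomialSum-suc m (suc d)) (binomialSum-suc m d) ⟨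
  binomialSum m (2 + d) + binomialSum m (suc d) ∎
  where
  open ≡-Reasoning

-- Pascal's rule and (m+1)^(e+1) + (m+1)^e = (m+2)(m+1)^e. Crude, but of the right degree for the
-- growth estimate.
binomialSum-≤ : ∀ m e → binomialSum m (suc e) ≤ suc m ^ e
binomialSum-≤ m zero = ℕ.≤-refl
binomialSum-≤ zero (suc e) = ℕ.≤-trans (ℕ.≤-reflexive (binomialSum-zero (suc e))) (ℕ.≤-reflexive (sym (ℕ.^-zeroˡ (suc e))))
binomialSum-≤ (suc m) (suc e) = begin
  binomialSum (suc m) (2 + e)
    ≡⟨ binomialSum-pascal m (suc e) ⟩
  binomialSum m (2 + e) + binomialSum m (suc e)
    ≤⟨ ℕ.+-mono-≤ (binomialSum-≤ m (suc e)) (binomialSum-≤ m e) ⟩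
  suc m * suc m ^ e + suc m ^ e
    ≡⟨ ℕ.+-comm (suc m * suc m ^ e) _ ⟩
  (2 + m) * suc m ^ e
    ≤⟨ ℕ.*-monoʳ-≤ (2 + m) (ℕ.^-monoˡ-≤ e (ℕ.n≤1+n (suc m))) ⟩
  (2 + m) * (2 + m) ^ e ∎
  where open ℕ.≤-Reasoning

-- Recursion on the first coordinate splits a family into its two restrictions by computation, as
-- the Sauer-Shelah induction requires.
count : ∀ {m} → (Vec Bool m → Bool) → ℕ
count {zero}  F = bool→ℕ (F [])
count {suc m} F = count (F ∘ (true ∷_)) + count (F ∘ (false ∷_))

count-cong : ∀ {m} {F G : Vec Bool m → Bool} → F ≗ G → count F ≡ count G
count-cong {zero}  F≗G = cong bool→ℕ (F≗G [])
count-cong {suc m} F≗G = cong₂ _+_ (count-cong (F≗G ∘ (true ∷_))) (count-cong (F≗G ∘ (false ∷_)))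

count-∨-∧ : ∀ {m} (F G : Vec Bool m → Bool) →
  count F + count G ≡ count (λ v → F v ∨ G v) + count (λ v → F v ∧ G v)
count-∨-∧ {zero} F G with F [] | G []
... | true  | true  = refl
... | true  | false = refl
... | false | true  = refl
... | false | false = refl
count-∨-∧ {suc m} F G = begin
  (count F₁ + count F₀) + (count G₁ + count G₀)
    ≡⟨ +-interchange (count F₁) (count F₀) (count G₁) (count G₀) ⟩
  (count F₁ + count G₁) + (count F₀ + count G₀)
    ≡⟨ cong₂ _+_ (count-∨-∧ F₁ G₁) (count-∨-∧ F₀ G₀) ⟩
  (∪₁ + ∩₁) + (∪₀ + ∩₀)
    ≡⟨ +-interchange ∪₁ ∩₁ ∪₀ ∩₀ ⟩
  (∪₁ + ∪₀) + (∩₁ + ∩₀) ∎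
  where
  open ≡-Reasoning
  F₁ = F ∘ (true ∷_)
  F₀ = F ∘ (false ∷_)
  G₁ = G ∘ (true ∷_)
  G₀ = G ∘ (false ∷_)
  ∪₁ ∩₁ ∪₀ ∩₀ : ℕ
  ∪₁ = count (λ v → F₁ v ∨ G₁ v)
  ∩₁ = count (λ v → F₁ v ∧ G₁ v)
  ∪₀ = count (λ v → F₀ v ∨ G₀ v)
  ∩₀ = count (λ v → F₀ v ∧ G₀ v)

count-pos : ∀ {m} (F : Vec Bool m → Bool) → 0 < count F → ∃ λ v → F v ≡ true
count-pos {zero} F 0<c with F [] in eq
... | true = [] , eq
count-pos {suc m} F 0<c with 1 ≤? count (F ∘ (true ∷_))
... | yes 0<c₁ = let v , Fv = count-pos (F ∘ (true ∷_)) 0<c₁ in true ∷ v , Fv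
... | no  0≮c₁ = let v , Fv = count-pos (F ∘ (false ∷_))
                                (subst (λ x → 0 < x + count (F ∘ (false ∷_))) (ℕ.n<1⇒n≡0 (ℕ.≰⇒> 0≮c₁)) 0<c)
                 in false ∷ v , Fv

_≟ᵛ_ : ∀ {m} (u v : Vec Bool m) → Dec (u ≡ v)
_≟ᵛ_ = ≡-dec Bool._≟_

delete : ∀ {m} → Vec Bool m → (Vec Bool m → Bool) → Vec Bool m → Bool
delete x F v = F v ∧ not (does (v ≟ᵛ x))

count-delete : ∀ {m} x (F : Vec Bool m → Bool) → F x ≡ true → count F ≡ suc (count (delete x F))
count-delete [] F Fx rewrite Fx = refl
count-delete (true ∷ x) F Fx = cong₂ _+_ (count-delete x (F ∘ (true ∷_)) Fx)
  (count-cong (λ v → sym (Bool.∧-identityʳ (F (false ∷ v)))))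
count-delete (false ∷ x) F Fx = trans (cong₂ _+_
  (count-cong (λ v → sym (Bool.∧-identityʳ (F (true ∷ v))))) (count-delete x (F ∘ (false ∷_)) Fx)) (ℕ.+-suc _ _)

length≤count : ∀ {m} (F : Vec Bool m → Bool) xs → Unique xs → All (λ v → F v ≡ true) xs → length xs ≤ count F
length≤count F [] _ _ = z≤n
length≤count F (x ∷ xs) (x∉xs ∷ unique) (Fx ∷ Fxs) =
  subst (suc (length xs) ≤_) (sym (count-delete x F Fx))
    (s≤s (length≤count (delete x F) xs unique (All.zipWith kept (x∉xs , Fxs))))
  where
  kept : ∀ {v} → (x ≢ v) × F v ≡ true → delete x F v ≡ true
  kept {v} (x≢v , Fv) = cong₂ (λ a b → a ∧ not b) Fv (dec-false (v ≟ᵛ x) (x≢v ∘ sym))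

-- Injectivity of `σ` is automatic: a repeated index could not realise a pattern taking two values
-- there.
Shatters : ∀ {m} → (Vec Bool m → Bool) → ℕ → Set
Shatters {m} F d = ∃ λ (σ : Fin d → Fin m) →
  ∀ (τ : Fin d → Bool) → ∃ λ v → F v ≡ true × (∀ i → lookup v (σ i) ≡ τ i)

-- Split by the first coordinate and take the union and the intersection of the two restrictions. A
-- large union shatters indices that avoid the first coordinate. Otherwise Pascal's rule makes the
-- intersection large; indices shattered by it can be joined by the first coordinate, whose value is
-- free there.
sauer-shelah : ∀ m d (F : Vec Bool m → Bool) → binomialSum m d < count F → Shatters F d
sauer-shelah m zero F big = (λ ()) , λ _ → let v , Fv = count-pos F big in v , Fv , λ ()
sauer-shelah zero (suc d) F big =
  contradiction (ℕ.<-≤-trans (subst (_< count F) (binomialSum-zero d) big) (bool→ℕ≤1 (F []))) (ℕ.<-irrefl refl)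
  where
  bool→ℕ≤1 : ∀ b → bool→ℕ b ≤ 1
  bool→ℕ≤1 true  = ℕ.≤-refl
  bool→ℕ≤1 false = z≤n
sauer-shelah (suc m) (suc d) F big with binomialSum m (suc d) ℕ.<? count (λ v → F (true ∷ v) ∨ F (false ∷ v))
... | yes union-big with sauer-shelah m (suc d) _ union-big
...   | σ , shatter = suc ∘ σ , λ τ → lift τ (shatter τ)
  where
  lift : ∀ τ → ∃ (λ v → (F (true ∷ v) ∨ F (false ∷ v)) ≡ true × (∀ i → lookup v (σ i) ≡ τ i)) →
         ∃ λ v → F v ≡ true × (∀ i → lookup v (suc (σ i)) ≡ τ i)
  lift τ (v , Fv , agree) with F (true ∷ v) in eq
  ... | true  = true ∷ v , eq , agree
  ... | false = false ∷ v , Fv , agree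
sauer-shelah (suc m) (suc d) F big | no union-small with sauer-shelah m d _ (ℕ.≰⇒> inter-small)
  where
  F₁ = F ∘ (true ∷_)
  F₀ = F ∘ (false ∷_)
  inter-small : ¬ (count (λ v → F₁ v ∧ F₀ v) ≤ binomialSum m d)
  inter-small small = ℕ.<⇒≱ big (begin
    count F₁ + count F₀
      ≡⟨ count-∨-∧ F₁ F₀ ⟩
    count (λ v → F₁ v ∨ F₀ v) + count (λ v → F₁ v ∧ F₀ v)
      ≤⟨ ℕ.+-mono-≤ (ℕ.≮⇒≥ union-small) small ⟩
    binomialSum m (suc d) + binomialSum m d
      ≡⟨ binomialSum-pascal m d ⟨
    binomialSum (suc m) (suc d) ∎)
    where open ℕ.≤-Reasoning
... | σ , shatter = σ′ , λ τ → lift τ (shatter (τ ∘ suc))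
  where
  σ′ : Fin (suc d) → Fin (suc m)
  σ′ zero    = zero
  σ′ (suc i) = suc (σ i)
  lift : ∀ τ → ∃ (λ v → (F (true ∷ v) ∧ F (false ∷ v)) ≡ true × (∀ i → lookup v (σ i) ≡ τ (suc i))) →
         ∃ λ v → F v ≡ true × (∀ i → lookup v (σ′ i) ≡ τ i)
  lift τ (v , Fv , agree) = τ zero ∷ v , member (τ zero) , λ { zero → refl ; (suc i) → agree i }
    where
    member : ∀ b → F (b ∷ v) ≡ true
    member true  = Bool.∧-conicalˡ _ _ Fv
    member false = Bool.∧-conicalʳ (F (true ∷ v)) _ Fv

-- Linear relations and the number of cells

-- Fraction-free Gaussian elimination on the first coordinate. With pivot row k and pivot `a`, the
-- rows `w i` = a r_i - r_i0 h_k have first entry 0, and a relation `μ` among them lifts to a μ_i on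
-- r_i and -Σ μ_i r_i0 on h_k; it stays nontrivial because a ≠ 0. Without a pivot the first
-- coordinate is dropped and one vector gets coefficient 0.
linearly-dependent : ∀ {d} (h : Fin (suc d) → Vector d) →
  ∃ λ (μ : Fin (suc d) → ℤ) → (∃ λ i → μ i ≢ 0ℤ) × (∀ j → sum (λ i → μ i ℤ.* h i j) ≡ 0ℤ)
linearly-dependent {zero} h = (λ _ → 1ℤ) , (zero , λ ()) , λ ()
linearly-dependent {suc d} h with all? (λ i → h i zero ℤ.≟ 0ℤ)
... | yes flat = extend (linearly-dependent (λ i j → h (suc i) (suc j)))
  where
  extend : (∃ λ (μ : Fin (suc d) → ℤ) → (∃ λ i → μ i ≢ 0ℤ) × (∀ j → sum (λ i → μ i ℤ.* h (suc i) (suc j)) ≡ 0ℤ)) → _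
  extend (μ , (i , μᵢ≢0) , relation) = μ′ , (suc i , μᵢ≢0) , relation′
    where
    μ′ : Fin (2 + d) → ℤ
    μ′ zero    = 0ℤ
    μ′ (suc i) = μ i
    relation′ : ∀ j → sum (λ i → μ′ i ℤ.* h i j) ≡ 0ℤ
    relation′ zero    = sum-zero (λ i → μ′ i ℤ.* h i zero) (λ i → trans (cong (μ′ i ℤ.*_) (flat i)) (ℤ.*-zeroʳ (μ′ i)))
    relation′ (suc j) = trans (ℤ.+-identityˡ (sum (λ i → μ i ℤ.* h (suc i) (suc j)))) (relation j)
... | no ¬flat with ¬∀⟶∃¬ _ _ (λ i → h i zero ℤ.≟ 0ℤ) ¬flat
...   | k , a≢0 = extend (linearly-dependent (λ i j → w i (suc j)))
  where
  a : ℤ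
  a = h k zero
  r : Fin (suc d) → Vector (suc d)
  r = h ∘ punchIn k
  w : Fin (suc d) → Vector (suc d)
  w i j = a ℤ.* r i j ℤ.- r i zero ℤ.* h k j
  extend : (∃ λ (μ : Fin (suc d) → ℤ) → (∃ λ i → μ i ≢ 0ℤ) × (∀ j → sum (λ i → μ i ℤ.* w i (suc j)) ≡ 0ℤ)) → _
  extend (μ , (i , μᵢ≢0) , relation) = μ′ , (punchIn k i , nonzero) , relation′
    where
    open ≡-Reasoning
    s : ℤ
    s = sum (λ i → μ i ℤ.* r i zero)
    μ′ : Fin (2 + d) → ℤ
    μ′ = insertAt (λ i → a ℤ.* μ i) k (ℤ.- s)
    nonzero : μ′ (punchIn k i) ≢ 0ℤ
    nonzero eq with ℤ.i*j≡0⇒i≡0∨j≡0 a (trans (sym (insertAt-punchIn (λ i → a ℤ.* μ i) k (ℤ.- s) i)) eq)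
    ... | inj₁ a≡0 = a≢0 a≡0
    ... | inj₂ μᵢ≡0 = μᵢ≢0 μᵢ≡0
    eliminated : ∀ j → sum (λ i → μ i ℤ.* w i j) ≡ 0ℤ
    eliminated zero    = sum-zero (λ i → μ i ℤ.* w i zero) (λ i → cancel (μ i) a (r i zero))
      where
      cancel : ∀ m a x → m ℤ.* (a ℤ.* x ℤ.- x ℤ.* a) ≡ 0ℤ
      cancel = solve-∀
    eliminated (suc j) = relation j
    relation′ : ∀ j → sum (λ i → μ′ i ℤ.* h i j) ≡ 0ℤ
    relation′ j = begin
      sum (λ i → μ′ i ℤ.* h i j)
        ≡⟨ sum-remove {i = k} (λ i → μ′ i ℤ.* h i j) ⟩
      μ′ k ℤ.* h k j ℤ.+ sum (λ i → μ′ (punchIn k i) ℤ.* r i j)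
        ≡⟨ cong₂ (λ x y → x ℤ.* h k j ℤ.+ y) (insertAt-lookup (λ i → a ℤ.* μ i) k (ℤ.- s))
                 (sum-cong-≗ (λ i → cong (ℤ._* r i j) (insertAt-punchIn (λ i → a ℤ.* μ i) k (ℤ.- s) i))) ⟩
      ℤ.- s ℤ.* h k j ℤ.+ sum (λ i → a ℤ.* μ i ℤ.* r i j)
        ≡⟨ cong (ℤ._+ sum (λ i → a ℤ.* μ i ℤ.* r i j)) (negate s (h k j)) ⟩
      s ℤ.* ℤ.- h k j ℤ.+ sum (λ i → a ℤ.* μ i ℤ.* r i j)
        ≡⟨ cong (ℤ._+ sum (λ i → a ℤ.* μ i ℤ.* r i j)) (*-distribʳ-sum (ℤ.- h k j) (λ i → μ i ℤ.* r i zero)) ⟩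
      sum (λ i → μ i ℤ.* r i zero ℤ.* ℤ.- h k j) ℤ.+ sum (λ i → a ℤ.* μ i ℤ.* r i j)
        ≡⟨ ∑-distrib-+ (λ i → μ i ℤ.* r i zero ℤ.* ℤ.- h k j) (λ i → a ℤ.* μ i ℤ.* r i j) ⟨
      sum (λ i → μ i ℤ.* r i zero ℤ.* ℤ.- h k j ℤ.+ a ℤ.* μ i ℤ.* r i j)
        ≡⟨ sum-cong-≗ (λ i → collect (μ i) (r i zero) (h k j) a (r i j)) ⟩
      sum (λ i → μ i ℤ.* w i j)
        ≡⟨ eliminated j ⟩
      0ℤ ∎
      where
      negate : ∀ s x → ℤ.- s ℤ.* x ≡ s ℤ.* ℤ.- x
      negate = solve-∀
      collect : ∀ m z x a y → m ℤ.* z ℤ.* ℤ.- x ℤ.+ a ℤ.* m ℤ.* y ≡ m ℤ.* (a ℤ.* y ℤ.- z ℤ.* x)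
      collect = solve-∀

-- Zero is filed under `false`, so `false` means negative only away from zero; genericity supplies
-- that.
isPos : ℤ → Bool
isPos x = does (0ℤ ℤ.<? x)

isPos⁻ : ∀ x → isPos x ≡ true → 0ℤ ℤ.< x
isPos⁻ x eq with 0ℤ ℤ.<? x
... | yes 0<x = 0<x

isPos-false⁻ : ∀ x → x ≢ 0ℤ → isPos x ≡ false → x ℤ.< 0ℤ
isPos-false⁻ x x≢0 eq with 0ℤ ℤ.<? x
... | no 0≮x = ℤ.≤∧≢⇒< (ℤ.≮⇒≥ 0≮x) x≢0

isPos⁺ : ∀ x → 0ℤ ℤ.< x → isPos x ≡ true
isPos⁺ x 0<x = dec-true (0ℤ ℤ.<? x) 0<x

isPos-false⁺ : ∀ x → x ℤ.< 0ℤ → isPos x ≡ false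
isPos-false⁺ x x<0 = dec-false (0ℤ ℤ.<? x) (ℤ.<-asym x<0)

isPos-neg : ∀ x → x ≢ 0ℤ → isPos (ℤ.- x) ≡ not (isPos x)
isPos-neg (+ zero)    x≢0 = contradiction refl x≢0
isPos-neg (+ suc _)   _   = refl
isPos-neg -[1+ _ ] _   = refl

-- Every term is nonnegative, and strictly positive where `μ` is nonzero. Where `μ` is zero the term
-- vanishes whatever the sign of `f`.
signs-agree⇒sum-pos : ∀ {n} (μ f : Fin n → ℤ) → (∃ λ i → μ i ≢ 0ℤ) → (∀ i → f i ≢ 0ℤ) →
  (∀ i → isPos (f i) ≡ isPos (μ i)) → 0ℤ ℤ.< sum (λ i → μ i ℤ.* f i)
signs-agree⇒sum-pos μ f (i₀ , μ≢0) f≢0 agree = sum-pos (λ i → μ i ℤ.* f i) nonNeg i₀ (pos i₀ μ≢0)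
  where
  pos : ∀ i → μ i ≢ 0ℤ → 0ℤ ℤ.< μ i ℤ.* f i
  pos i μᵢ≢0 with isPos (μ i) in eq
  ... | true  = pos*pos (isPos⁻ (μ i) eq) (isPos⁻ (f i) (trans (agree i) eq))
  ... | false = neg*neg (isPos-false⁻ (μ i) μᵢ≢0 eq) (isPos-false⁻ (f i) (f≢0 i) (trans (agree i) eq))
  nonNeg : ∀ i → 0ℤ ℤ.≤ μ i ℤ.* f i
  nonNeg i with μ i ℤ.≟ 0ℤ
  ... | yes μᵢ≡0 = ℤ.≤-reflexive (sym (cong (ℤ._* f i) μᵢ≡0))
  ... | no  μᵢ≢0 = ℤ.<⇒≤ (pos i μᵢ≢0)

dot-relation : ∀ {n d} (μ : Fin n → ℤ) (h : Fin n → Vector d) → (∀ j → sum (λ i → μ i ℤ.* h i j) ≡ 0ℤ) →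
  ∀ c → sum (λ i → μ i ℤ.* dot c (h i)) ≡ 0ℤ
dot-relation μ h relation c = begin
  sum (λ i → μ i ℤ.* dot c (h i))
    ≡⟨ sum-cong-≗ (λ i → *-distribˡ-sum (μ i) (λ j → c j ℤ.* h i j)) ⟩
  sum (λ i → sum (λ j → μ i ℤ.* (c j ℤ.* h i j)))
    ≡⟨ ∑-comm (λ i j → μ i ℤ.* (c j ℤ.* h i j)) ⟩
  sum (λ j → sum (λ i → μ i ℤ.* (c j ℤ.* h i j)))
    ≡⟨ sum-zero _ vanish ⟩
  0ℤ ∎
  where
  open ≡-Reasoning
  swap : ∀ m c x → m ℤ.* (c ℤ.* x) ≡ c ℤ.* (m ℤ.* x)
  swap = solve-∀
  vanish : ∀ j → sum (λ i → μ i ℤ.* (c j ℤ.* h i j)) ≡ 0ℤ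
  vanish j = begin
    sum (λ i → μ i ℤ.* (c j ℤ.* h i j))  ≡⟨ sum-cong-≗ (λ i → swap (μ i) (c j) (h i j)) ⟩
    sum (λ i → c j ℤ.* (μ i ℤ.* h i j))  ≡⟨ *-distribˡ-sum (c j) (λ i → μ i ℤ.* h i j) ⟨
    c j ℤ.* sum (λ i → μ i ℤ.* h i j)    ≡⟨ cong (c j ℤ.*_) (relation j) ⟩
    c j ℤ.* 0ℤ                           ≡⟨ ℤ.*-zeroʳ (c j) ⟩
    0ℤ                                   ∎

Generic : ∀ {m d} → (Fin m → Vector d) → Vector d → Set
Generic h c = ∀ i → dot c (h i) ≢ 0ℤ

cell : ∀ {m d} → (Fin m → Vector d) → Vector d → Vec Bool m
cell h c = tabulate (λ i → isPos (dot c (h i)))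

-- A relation with coefficients `μ` makes Σ μ_i (c · h_i) vanish, so no generic `c` has the signs of
-- `μ`; applied to -c, it excludes the opposite signs too. One of these two patterns starts with
-- `b`.
missing-signs : ∀ {d} (h : Fin (suc d) → Vector d) b → ∃ λ (τ : Fin (suc d) → Bool) → τ zero ≡ b ×
  (∀ c → Generic h c → ¬ (∀ i → isPos (dot c (h i)) ≡ τ i))
missing-signs h b with linearly-dependent h
... | μ , nontrivial , relation with isPos (μ zero) Bool.≟ b
...   | yes eq = (λ i → isPos (μ i)) , eq , λ c generic agree →
        ℤ.<-irrefl (sym (dot-relation μ h relation c))
          (signs-agree⇒sum-pos μ (λ i → dot c (h i)) nontrivial generic agree)
...   | no neq = (λ i → not (isPos (μ i))) , sym (Bool.¬-not (neq ∘ sym)) , λ c generic agree →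
        ℤ.<-irrefl (sym (dot-relation μ h relation (neg c)))
          (signs-agree⇒sum-pos μ (λ i → dot (neg c) (h i)) nontrivial
            (λ i eq → generic i (trans (sym (ℤ.neg-involutive _)) (cong ℤ.-_ (trans (sym (dot-negˡ c (h i))) eq))))
            (λ i → trans (cong isPos (dot-negˡ c (h i))) (trans (isPos-neg (dot c (h i)) (generic i))
              (trans (cong not (agree i)) (Bool.not-involutive _)))))

-- Fixing the sign of h zero, a shattered d-set of the other forms would realise every sign pattern with
-- that first sign on d + 1 linearly dependent forms; so Sauer–Shelah bounds each of the two halves.
cells-bound : ∀ {m d} (h : Fin (suc m) → Vector d) (cs : List (Vector d)) → All (Generic h) cs →
  AllPairs (λ c c′ → cell h c ≢ cell h c′) cs → length cs ≤ 2 * binomialSum m d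
cells-bound {m} {d} h cs generic distinct = begin
  length cs                                        ≡⟨ length-map (cell h) cs ⟨
  length (map (cell h) cs)                         ≤⟨ length≤count F (map (cell h) cs) (AllPairs.map⁺ distinct)
                                                       (All.tabulate (λ {v} → dec-true (v ∈? map (cell h) cs))) ⟩
  count (F ∘ (true ∷_)) + count (F ∘ (false ∷_))   ≤⟨ ℕ.+-mono-≤ (half true) (half false) ⟩
  binomialSum m d + binomialSum m d                ≡⟨ cong (λ x → binomialSum m d + x) (ℕ.+-identityʳ _) ⟨
  2 * binomialSum m d                              ∎
  where
  open ℕ.≤-Reasoning
  open import Data.List.Membership.DecPropositional (_≟ᵛ_ {suc m}) using (_∈?_)
  F : Vec Bool (suc m) → Bool
  F v = does (v ∈? map (cell h) cs)
  F⁻ : ∀ v → F v ≡ true → ∃ λ c → Generic h c × v ≡ cell h c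
  F⁻ v Fv with v ∈? map (cell h) cs
  ... | yes v∈ = let c , c∈cs , eq = ∈-map⁻ (cell h) v∈ in c , All.lookup generic c∈cs , eq
  half : ∀ b → count (F ∘ (b ∷_)) ≤ binomialSum m d
  half b = ℕ.≮⇒≥ λ big → unshattered (sauer-shelah m d (F ∘ (b ∷_)) big)
    where
    unshattered : ¬ Shatters (F ∘ (b ∷_)) d
    unshattered (σ , shatter) = impossible (missing-signs h′ b)
      where
      σ′ : Fin (suc d) → Fin (suc m)
      σ′ zero    = zero
      σ′ (suc i) = suc (σ i)
      h′ : Fin (suc d) → Vector d
      h′ = h ∘ σ′
      impossible : ¬ ∃ λ (τ : Fin (suc d) → Bool) → τ zero ≡ b ×
        (∀ c → Generic h′ c → ¬ (∀ i → isPos (dot c (h′ i)) ≡ τ i))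
      impossible (τ , τ₀ , missing) with shatter (τ ∘ suc)
      ... | v , Fv , agree with F⁻ (b ∷ v) Fv
      ...   | c , gen , b∷v≡cell = missing c (gen ∘ σ′) signs
        where
        entry : ∀ i → isPos (dot c (h i)) ≡ lookup (b ∷ v) i
        entry i = trans (sym (lookup∘tabulate (λ i → isPos (dot c (h i))) i)) (cong (λ u → lookup u i) (sym b∷v≡cell))
        signs : ∀ i → isPos (dot c (h′ i)) ≡ τ i
        signs zero    = trans (entry zero) (sym τ₀)
        signs (suc i) = trans (entry (suc (σ i))) (agree i)

-- Convex hulls and separating functionals

-- Definitionally extends `ℕ→ℚ`, so that objective values can be computed in ℤ and compared with the
-- rational sums of `InConvHull`.
ι : ℤ → ℚ
ι i = i ℚ./ 1

ι-unnormalised : ∀ i → toℚᵘ (ι i) ℚᵘ.≃ mkℚᵘ i 0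
ι-unnormalised i = ℚ.toℚᵘ-fromℚᵘ (mkℚᵘ i 0)

ι-+ : ∀ i j → ι (i ℤ.+ j) ≡ ι i ℚ.+ ι j
ι-+ i j = ℚ.toℚᵘ-injective (begin
  toℚᵘ (ι (i ℤ.+ j))            ≈⟨ ι-unnormalised (i ℤ.+ j) ⟩
  mkℚᵘ (i ℤ.+ j) 0              ≈⟨ ℚᵘ.*≡* (cross i j) ⟩
  mkℚᵘ i 0 ℚᵘ.+ mkℚᵘ j 0        ≈⟨ ℚᵘ.+-cong (ι-unnormalised i) (ι-unnormalised j) ⟨
  toℚᵘ (ι i) ℚᵘ.+ toℚᵘ (ι j)    ≈⟨ ℚ.toℚᵘ-homo-+ (ι i) (ι j) ⟨
  toℚᵘ (ι i ℚ.+ ι j)            ∎)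
  where
  open import Relation.Binary.Reasoning.Setoid ℚᵘ.≃-setoid
  cross : ∀ i j → (i ℤ.+ j) ℤ.* 1ℤ ≡ (i ℤ.* 1ℤ ℤ.+ j ℤ.* 1ℤ) ℤ.* 1ℤ
  cross = solve-∀

ι-* : ∀ i j → ι (i ℤ.* j) ≡ ι i ℚ.* ι j
ι-* i j = ℚ.toℚᵘ-injective (begin
  toℚᵘ (ι (i ℤ.* j))            ≈⟨ ι-unnormalised (i ℤ.* j) ⟩
  mkℚᵘ i 0 ℚᵘ.* mkℚᵘ j 0        ≈⟨ ℚᵘ.*-cong (ι-unnormalised i) (ι-unnormalised j) ⟨
  toℚᵘ (ι i) ℚᵘ.* toℚᵘ (ι j)    ≈⟨ ℚ.toℚᵘ-homo-* (ι i) (ι j) ⟨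
  toℚᵘ (ι i ℚ.* ι j)            ∎)
  where open import Relation.Binary.Reasoning.Setoid ℚᵘ.≃-setoid

ι-mono-≤ : ∀ {i j} → i ℤ.≤ j → ι i ℚ.≤ ι j
ι-mono-≤ {i} {j} i≤j = ℚ.toℚᵘ-cancel-≤
  (ℚᵘ.≤-respˡ-≃ (ℚᵘ.≃-sym (ι-unnormalised i)) (ℚᵘ.≤-respʳ-≃ (ℚᵘ.≃-sym (ι-unnormalised j))
    (ℚᵘ.*≤* (ℤ.*-monoʳ-≤-nonNeg 1ℤ i≤j))))

coordinates : ∀ {d} → Point d → Vector d
coordinates p i = + p i

objective : ∀ {d} → Vector d → Point d → ℤ
objective c p = dot c (coordinates p)

objective-cong : ∀ {d} (c : Vector d) {p q} → p ≐ q → objective c p ≡ objective c q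
objective-cong c p≐q = dot-congʳ c (λ i → cong +_ (p≐q i))

weightedSum : ∀ {A : Set} → (A → ℚ) → List (ℚ × A) → ℚ
weightedSum f cs = sumℚ (map (λ c → proj₁ c ℚ.* f (proj₂ c)) cs)

module _ {A : Set} where

  weightedSum-cong : ∀ {f g : A → ℚ} → f ≗ g → weightedSum f ≗ weightedSum g
  weightedSum-cong f≗g []             = refl
  weightedSum-cong f≗g ((l , a) ∷ cs) = cong₂ ℚ._+_ (cong (l ℚ.*_) (f≗g a)) (weightedSum-cong f≗g cs)

  weightedSum-+ : ∀ (f g : A → ℚ) cs →
    weightedSum (λ a → f a ℚ.+ g a) cs ≡ weightedSum f cs ℚ.+ weightedSum g cs
  weightedSum-+ f g []             = refl
  weightedSum-+ f g ((l , a) ∷ cs) = begin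
    l ℚ.* (f a ℚ.+ g a) ℚ.+ weightedSum (λ a → f a ℚ.+ g a) cs
      ≡⟨ cong₂ ℚ._+_ (ℚ.*-distribˡ-+ l (f a) (g a)) (weightedSum-+ f g cs) ⟩
    (l ℚ.* f a ℚ.+ l ℚ.* g a) ℚ.+ (weightedSum f cs ℚ.+ weightedSum g cs)
      ≡⟨ ℚ-interchange (l ℚ.* f a) (l ℚ.* g a) (weightedSum f cs) (weightedSum g cs) ⟩
    weightedSum f ((l , a) ∷ cs) ℚ.+ weightedSum g ((l , a) ∷ cs) ∎
    where open ≡-Reasoning

  weightedSum-* : ∀ k (f : A → ℚ) cs → weightedSum (λ a → k ℚ.* f a) cs ≡ k ℚ.* weightedSum f cs
  weightedSum-* k f []             = sym (ℚ.*-zeroʳ k)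
  weightedSum-* k f ((l , a) ∷ cs) = begin
    l ℚ.* (k ℚ.* f a) ℚ.+ weightedSum (λ a → k ℚ.* f a) cs
      ≡⟨ cong₂ ℚ._+_ move (weightedSum-* k f cs) ⟩
    k ℚ.* (l ℚ.* f a) ℚ.+ k ℚ.* weightedSum f cs
      ≡⟨ ℚ.*-distribˡ-+ k (l ℚ.* f a) (weightedSum f cs) ⟨
    k ℚ.* weightedSum f ((l , a) ∷ cs) ∎
    where
    open ≡-Reasoning
    move : l ℚ.* (k ℚ.* f a) ≡ k ℚ.* (l ℚ.* f a)
    move = trans (sym (ℚ.*-assoc l k (f a))) (trans (cong (ℚ._* f a) (ℚ.*-comm l k)) (ℚ.*-assoc k l (f a)))

  weightedSum-const : ∀ k (cs : List (ℚ × A)) → sumℚ (map proj₁ cs) ≡ 1ℚ → weightedSum (λ _ → k) cs ≡ k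
  weightedSum-const k cs total = trans (trans (factor cs) (cong (ℚ._* k) total)) (ℚ.*-identityˡ k)
    where
    factor : ∀ cs → weightedSum (λ _ → k) cs ≡ sumℚ (map proj₁ cs) ℚ.* k
    factor []             = sym (ℚ.*-zeroˡ k)
    factor ((l , a) ∷ cs) = trans (cong (λ x → l ℚ.* k ℚ.+ x) (factor cs)) (sym (ℚ.*-distribʳ-+ k l (sumℚ (map proj₁ cs))))

  weightedSum-mono : ∀ (f g : A → ℚ) cs → All (λ c → 0ℚ ℚ.≤ proj₁ c × f (proj₂ c) ℚ.≤ g (proj₂ c)) cs →
    weightedSum f cs ℚ.≤ weightedSum g cs
  weightedSum-mono f g [] [] = ℚ.≤-refl
  weightedSum-mono f g ((l , a) ∷ cs) ((0≤l , fa≤ga) ∷ rest) =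
    ℚ.+-mono-≤ (ℚ.*-monoˡ-≤-nonNeg l {{ℚ.nonNegative 0≤l}} fa≤ga) (weightedSum-mono f g cs rest)

weightedSum-objective : ∀ {d} (cs : List (ℚ × Point d)) (p : Point d) →
  (∀ i → weightedSum (λ q → ℕ→ℚ (q i)) cs ≡ ℕ→ℚ (p i)) →
  ∀ c → weightedSum (ι ∘ objective c) cs ≡ ι (objective c p)
weightedSum-objective {d} cs p barycentre c = partial d c id
  where
  -- The induction shortens `c` while the points keep all their coordinates; `e` tells which
  -- coordinates the remaining entries of `c` refer to.
  partial : ∀ k (c : Vector k) (e : Fin k → Fin d) →
    weightedSum (λ q → ι (dot c (coordinates q ∘ e))) cs ≡ ι (dot c (coordinates p ∘ e))
  partial zero c e = zeros cs
    where
    zeros : ∀ (cs : List (ℚ × Point d)) → weightedSum (λ _ → 0ℚ) cs ≡ 0ℚ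
    zeros []             = refl
    zeros ((l , _) ∷ cs) = cong₂ ℚ._+_ (ℚ.*-zeroʳ l) (zeros cs)
  partial (suc k) c e = begin
    weightedSum (λ q → ι (c zero ℤ.* + q (e zero) ℤ.+ tailDot q)) cs
      ≡⟨ weightedSum-cong (λ q → trans (ι-+ (c zero ℤ.* + q (e zero)) (tailDot q))
           (cong (ℚ._+ ι (tailDot q)) (ι-* (c zero) (+ q (e zero))))) cs ⟩
    weightedSum (λ q → ι (c zero) ℚ.* ι (+ q (e zero)) ℚ.+ ι (tailDot q)) cs
      ≡⟨ weightedSum-+ (λ q → ι (c zero) ℚ.* ι (+ q (e zero))) (ι ∘ tailDot) cs ⟩
    weightedSum (λ q → ι (c zero) ℚ.* ι (+ q (e zero))) cs ℚ.+ weightedSum (ι ∘ tailDot) cs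
      ≡⟨ cong₂ ℚ._+_ (trans (weightedSum-* (ι (c zero)) (λ q → ι (+ q (e zero))) cs)
                       (cong (ι (c zero) ℚ.*_) (barycentre (e zero))))
                     (partial k (c ∘ suc) (e ∘ suc)) ⟩
    ι (c zero) ℚ.* ι (+ p (e zero)) ℚ.+ ι (tailDot p)
      ≡⟨ cong (ℚ._+ ι (tailDot p)) (ι-* (c zero) (+ p (e zero))) ⟨
    ι (c zero ℤ.* + p (e zero)) ℚ.+ ι (tailDot p)
      ≡⟨ ι-+ (c zero ℤ.* + p (e zero)) (tailDot p) ⟨
    ι (c zero ℤ.* + p (e zero) ℤ.+ tailDot p) ∎
    where
    open ≡-Reasoning
    tailDot : Point d → ℤ
    tailDot q = dot (c ∘ suc) (coordinates q ∘ e ∘ suc)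

-- By integrality each point of `P` falls short of `p` by at least 1, hence so does every convex
-- combination. The uniform gap makes it unnecessary to look for a positive weight.
separated⇒∉hull : ∀ {d} (c : Vector d) (p : Point d) (P : Point d → Set) →
  (∀ q → P q → objective c q ℤ.< objective c p) → ¬ InConvHull P p
separated⇒∉hull c p P below (cs , valid , total , barycentre) =
  ℚ.<-irrefl refl (ℚ.<-≤-trans x<1+x 1+x≤x)
  where
  x : ℚ
  x = ι (objective c p)
  x<1+x : x ℚ.< 1ℚ ℚ.+ x
  x<1+x = subst (ℚ._< 1ℚ ℚ.+ x) (ℚ.+-identityˡ x) (ℚ.+-monoˡ-< x (ℚ.positive⁻¹ 1ℚ))
  1+x≤x : 1ℚ ℚ.+ x ℚ.≤ x
  1+x≤x = begin
    1ℚ ℚ.+ x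
      ≡⟨ cong₂ ℚ._+_ (weightedSum-const 1ℚ cs total) (weightedSum-objective cs p barycentre c) ⟨
    weightedSum (λ _ → 1ℚ) cs ℚ.+ weightedSum (ι ∘ objective c) cs
      ≡⟨ weightedSum-+ (λ _ → 1ℚ) (ι ∘ objective c) cs ⟨
    weightedSum (λ q → 1ℚ ℚ.+ ι (objective c q)) cs
      ≤⟨ weightedSum-mono _ (λ _ → x) cs (All.map gap valid) ⟩
    weightedSum (λ _ → x) cs
      ≡⟨ weightedSum-const x cs total ⟩
    x ∎
    where
    open ℚ.≤-Reasoning
    gap : ∀ {c′} → 0ℚ ℚ.≤ proj₁ c′ × P (proj₂ c′) → 0ℚ ℚ.≤ proj₁ c′ × 1ℚ ℚ.+ ι (objective c (proj₂ c′)) ℚ.≤ x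
    gap {_ , q} (0≤l , Pq) = 0≤l , subst (ℚ._≤ x) (ι-+ 1ℤ (objective c q)) (ι-mono-≤ (ℤ.i<j⇒suc[i]≤j (below q Pq)))

-- Repetitions in the list act as integer coefficients, so elements of the cone of differences are
-- added by concatenating lists.
gaps : ∀ {d} → Point d → List (Point d) → Vector d
gaps p []       i = 0ℤ
gaps p (q ∷ qs) i = (+ p i ℤ.- + q i) ℤ.+ gaps p qs i

gaps-++ : ∀ {d} (p : Point d) qs rs i → gaps p (qs ++ rs) i ≡ gaps p qs i ℤ.+ gaps p rs i
gaps-++ p []       rs i = sym (ℤ.+-identityˡ _)
gaps-++ p (q ∷ qs) rs i = trans (cong (λ x → (+ p i ℤ.- + q i) ℤ.+ x) (gaps-++ p qs rs i))
                            (sym (ℤ.+-assoc (+ p i ℤ.- + q i) (gaps p qs i) (gaps p rs i)))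

-- If the differences cancel, `p` is the average of the list, with equal weights `r`. The separate
-- head `q` makes the length invertible.
zero-gaps⇒∈hull : ∀ {d} (P : Point d → Set) (p q : Point d) qs → All P (q ∷ qs) →
  IsZero (gaps p (q ∷ qs)) → InConvHull P p
zero-gaps⇒∈hull {d} P p q qs all-P balanced =
  map (r ,_) all , All.map⁺ (All.map (0≤r ,_) all-P) , trans (weights all) (ℚ.*-inverseʳ Λ) , barycentre
  where
  all : List (Point d)
  all = q ∷ qs
  Λ : ℚ
  Λ = ι (+ length all)
  instance
    Λ-pos : ℚ.Positive Λ
    Λ-pos = ℚ.normalize-pos (length all) 1
    Λ-nonZero : ℚ.NonZero Λ
    Λ-nonZero = ℚ.pos⇒nonZero Λ
  r : ℚ
  r = ℚ.1/ Λ
  0≤r : 0ℚ ℚ.≤ r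
  0≤r = ℚ.<⇒≤ (ℚ.positive⁻¹ r {{ℚ.1/pos⇒pos Λ}})
  weights : ∀ qs → sumℚ (map proj₁ (map (r ,_) qs)) ≡ ι (+ length qs) ℚ.* r
  weights []       = sym (ℚ.*-zeroˡ r)
  weights (q ∷ qs) = begin
    r ℚ.+ sumℚ (map proj₁ (map (r ,_) qs))    ≡⟨ cong₂ ℚ._+_ (sym (ℚ.*-identityˡ r)) (weights qs) ⟩
    1ℚ ℚ.* r ℚ.+ ι (+ length qs) ℚ.* r        ≡⟨ ℚ.*-distribʳ-+ r 1ℚ (ι (+ length qs)) ⟨
    (1ℚ ℚ.+ ι (+ length qs)) ℚ.* r            ≡⟨ cong (ℚ._* r) (ι-+ 1ℤ (+ length qs)) ⟨
    ι (+ length (q ∷ qs)) ℚ.* r               ∎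
    where open ≡-Reasoning
  moments : ∀ qs i → weightedSum (λ q → ℕ→ℚ (q i)) (map (r ,_) qs) ≡ r ℚ.* ι (+ length qs ℤ.* + p i ℤ.- gaps p qs i)
  moments []       i = sym (ℚ.*-zeroʳ r)
  moments (q ∷ qs) i = begin
    r ℚ.* ι (+ q i) ℚ.+ weightedSum (λ q → ℕ→ℚ (q i)) (map (r ,_) qs)
      ≡⟨ cong (λ x → r ℚ.* ι (+ q i) ℚ.+ x) (moments qs i) ⟩
    r ℚ.* ι (+ q i) ℚ.+ r ℚ.* ι rest
      ≡⟨ ℚ.*-distribˡ-+ r (ι (+ q i)) (ι rest) ⟨
    r ℚ.* (ι (+ q i) ℚ.+ ι rest)
      ≡⟨ cong (r ℚ.*_) (ι-+ (+ q i) rest) ⟨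
    r ℚ.* ι (+ q i ℤ.+ rest)
      ≡⟨ cong (λ x → r ℚ.* ι x) (rearrange (+ q i) (+ length qs) (+ p i) (gaps p qs i)) ⟩
    r ℚ.* ι (+ length (q ∷ qs) ℤ.* + p i ℤ.- gaps p (q ∷ qs) i) ∎
    where
    open ≡-Reasoning
    rest : ℤ
    rest = + length qs ℤ.* + p i ℤ.- gaps p qs i
    rearrange : ∀ q n p g → q ℤ.+ (n ℤ.* p ℤ.- g) ≡ (1ℤ ℤ.+ n) ℤ.* p ℤ.- ((p ℤ.- q) ℤ.+ g)
    rearrange = solve-∀
  barycentre : ∀ i → weightedSum (λ q → ℕ→ℚ (q i)) (map (r ,_) all) ≡ ℕ→ℚ (p i)
  barycentre i = begin
    weightedSum (λ q → ℕ→ℚ (q i)) (map (r ,_) all)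
      ≡⟨ moments all i ⟩
    r ℚ.* ι (+ length all ℤ.* + p i ℤ.- gaps p all i)
      ≡⟨ cong (λ x → r ℚ.* ι (+ length all ℤ.* + p i ℤ.- x)) (balanced i) ⟩
    r ℚ.* ι (+ length all ℤ.* + p i ℤ.+ 0ℤ)
      ≡⟨ cong (λ x → r ℚ.* ι x) (ℤ.+-identityʳ (+ length all ℤ.* + p i)) ⟩
    r ℚ.* ι (+ length all ℤ.* + p i)
      ≡⟨ cong (r ℚ.*_) (ι-* (+ length all) (+ p i)) ⟩
    r ℚ.* (Λ ℚ.* ι (+ p i))
      ≡⟨ ℚ.*-assoc r Λ (ι (+ p i)) ⟨
    (r ℚ.* Λ) ℚ.* ι (+ p i)
      ≡⟨ cong (ℚ._* ι (+ p i)) (ℚ.*-inverseˡ Λ) ⟩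
    1ℚ ℚ.* ι (+ p i)
      ≡⟨ ℚ.*-identityˡ (ι (+ p i)) ⟩
    ι (+ p i) ∎
    where open ≡-Reasoning

-- Ternary forms

data Trit : Set where
  ⊖ ⊙ ⊕ : Trit

value : Trit → ℤ
value ⊖ = -1ℤ
value ⊙ = 0ℤ
value ⊕ = 1ℤ

flip : Trit → Trit
flip ⊖ = ⊕
flip ⊙ = ⊙
flip ⊕ = ⊖

value-flip : ∀ t → value (flip t) ≡ ℤ.- value t
value-flip ⊖ = refl
value-flip ⊙ = refl
value-flip ⊕ = refl

⟦_⟧ : ∀ {d} → Vec Trit d → Vector d
⟦ g ⟧ i = value (lookup g i)

trits : ∀ d → List (Vec Trit d)
trits zero    = [] ∷ []
trits (suc d) = map (⊖ ∷_) (trits d) ++ map (⊙ ∷_) (trits d) ++ map (⊕ ∷_) (trits d)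

∈-trits : ∀ {d} (g : Vec Trit d) → g ∈ trits d
∈-trits []      = here refl
∈-trits {suc d} (⊖ ∷ g) = ∈-++⁺ˡ (∈-map⁺ (⊖ ∷_) (∈-trits g))
∈-trits {suc d} (⊙ ∷ g) = ∈-++⁺ʳ (map (⊖ ∷_) (trits d)) (∈-++⁺ˡ (∈-map⁺ (⊙ ∷_) (∈-trits g)))
∈-trits {suc d} (⊕ ∷ g) = ∈-++⁺ʳ (map (⊖ ∷_) (trits d)) (∈-++⁺ʳ (map (⊙ ∷_) (trits d)) (∈-map⁺ (⊕ ∷_) (∈-trits g)))

length-trits : ∀ d → length (trits d) ≡ 3 ^ d
length-trits zero    = refl
length-trits (suc d) = begin
  length (map (⊖ ∷_) (trits d) ++ map (⊙ ∷_) (trits d) ++ map (⊕ ∷_) (trits d))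
    ≡⟨ length-++ (map (⊖ ∷_) (trits d)) ⟩
  length (map (⊖ ∷_) (trits d)) + length (map (⊙ ∷_) (trits d) ++ map (⊕ ∷_) (trits d))
    ≡⟨ cong₂ _+_ (len ⊖) (trans (length-++ (map (⊙ ∷_) (trits d))) (cong₂ _+_ (len ⊙) (trans (len ⊕) (sym (ℕ.+-identityʳ _))))) ⟩
  3 * 3 ^ d ∎
  where
  open ≡-Reasoning
  len : ∀ t → length (map (t ∷_) (trits d)) ≡ 3 ^ d
  len t = trans (length-map (t ∷_) (trits d)) (length-trits d)

-- One representative of each pair ± g of nonzero ternary vectors: those whose first nonzero entry is 1.
half : ∀ d → List (Vec Trit d)
half zero    = []
half (suc d) = map (⊙ ∷_) (half d) ++ map (⊕ ∷_) (trits d)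

length-half-suc : ∀ d → length (half (suc d)) ≡ length (half d) + 3 ^ d
length-half-suc d = trans (length-++ (map (⊙ ∷_) (half d)))
  (cong₂ _+_ (length-map (⊙ ∷_) (half d)) (trans (length-map (⊕ ∷_) (trits d)) (length-trits d)))

length-half : ∀ d → 1 + 2 * length (half d) ≡ 3 ^ d
length-half zero    = refl
length-half (suc d) = begin
  1 + 2 * length (half (suc d))          ≡⟨ cong (λ x → 1 + 2 * x) (length-half-suc d) ⟩
  1 + 2 * (length (half d) + 3 ^ d)      ≡⟨ expand (length (half d)) (3 ^ d) ⟩
  1 + 2 * length (half d) + 2 * 3 ^ d    ≡⟨ cong (λ x → x + 2 * 3 ^ d) (length-half d) ⟩
  3 * 3 ^ d                              ∎
  where
  open ≡-Reasoning
  expand : ∀ x y → 1 + 2 * (x + y) ≡ 1 + 2 * x + 2 * y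
  expand = solveℕ-∀

-- This is the source of (3^d - 3)/2: the forms that remain once one has been set aside to have its
-- sign fixed.
length-half-pred : ∀ d → 1 ≤ d → length (half d) ≡ suc ((3 ^ d ∸ 3) / 2)
length-half-pred (suc d) _ with length (half (suc d)) in eq
... | zero  = contradiction (trans (sym eq) (length-half-suc d)) (ℕ.<⇒≢ (ℕ.<-≤-trans (ℕ.m^n>0 3 d) (ℕ.m≤n+m (3 ^ d) (length (half d)))))
... | suc l = cong suc (begin
  l                                  ≡⟨ m*n/n≡m l 2 ⟨
  l * 2 / 2                 ≡⟨ cong (_/ 2) (trans (ℕ.*-comm l 2) (sym (minus3 l))) ⟩
  (1 + 2 * suc l ∸ 3) / 2   ≡⟨ cong (λ x → (x ∸ 3) / 2) (trans (cong (λ x → 1 + 2 * x) (sym eq)) (length-half (suc d))) ⟩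
  (3 ^ suc d ∸ 3) / 2       ∎)
  where
  open ≡-Reasoning
  minus3 : ∀ l → 1 + 2 * suc l ∸ 3 ≡ 2 * l
  minus3 l = cong (_∸ 2) (ℕ.*-suc 2 l)

half-nonzero : ∀ {d} {g : Vec Trit d} → g ∈ half d → ¬ IsZero ⟦ g ⟧
half-nonzero {suc d} g∈ g≡0 with ∈-++⁻ (map (⊙ ∷_) (half d)) g∈
... | inj₁ g∈⊙ with ∈-map⁻ (⊙ ∷_) g∈⊙
...   | g′ , g′∈ , refl = half-nonzero g′∈ (g≡0 ∘ suc)
half-nonzero {suc d} g∈ g≡0 | inj₂ g∈⊕ with ∈-map⁻ (⊕ ∷_) g∈⊕
...   | g′ , g′∈ , refl with () ← g≡0 zero

half-covers : ∀ {d} (g : Vec Trit d) → IsZero ⟦ g ⟧ ⊎ g ∈ half d ⊎ Vec.map flip g ∈ half d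
half-covers [] = inj₁ λ ()
half-covers {suc d} (⊖ ∷ g) = inj₂ (inj₂ (∈-++⁺ʳ (map (⊙ ∷_) (half d)) (∈-map⁺ (⊕ ∷_) (∈-trits (Vec.map flip g)))))
half-covers {suc d} (⊕ ∷ g) = inj₂ (inj₁ (∈-++⁺ʳ (map (⊙ ∷_) (half d)) (∈-map⁺ (⊕ ∷_) (∈-trits g))))
half-covers (⊙ ∷ g) with half-covers g
... | inj₁ g≡0         = inj₁ λ { zero → refl ; (suc i) → g≡0 i }
... | inj₂ (inj₁ g∈)   = inj₂ (inj₁ (∈-++⁺ˡ (∈-map⁺ (⊙ ∷_) g∈)))
... | inj₂ (inj₂ -g∈)  = inj₂ (inj₂ (∈-++⁺ˡ (∈-map⁺ (⊙ ∷_) -g∈)))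

dot-flip : ∀ {d} (c : Vector d) g → dot c ⟦ Vec.map flip g ⟧ ≡ ℤ.- dot c ⟦ g ⟧
dot-flip c g = trans
  (dot-congʳ c (λ i → trans (cong value (lookup-map i flip g)) (value-flip (lookup g i)))) (dot-negʳ c ⟦ g ⟧)

forms : ∀ d → Fin (length (half d)) → Vector d
forms d i = ⟦ List.lookup (half d) i ⟧

genericise : ∀ {d} (us : List (Vector d)) c → ∃ λ c′ →
  All (λ u → 0ℤ ℤ.< dot c u → 0ℤ ℤ.< dot c′ u) us × Generic (forms d) c′
genericise {d} us c with perturb (map ⟦_⟧ (half d)) us c
... | c′ , preserved , off = c′ , preserved , λ i → avoid i (All.lookup off (∈-map⁺ ⟦_⟧ (∈-lookup i)))
  where
  avoid : ∀ i → IsZero (forms d i) ⊎ dot c′ (forms d i) ≢ 0ℤ → dot c′ (forms d i) ≢ 0ℤ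
  avoid i (inj₁ form≡0) = contradiction form≡0 (half-nonzero (∈-lookup i))
  avoid i (inj₂ c′≢0)   = c′≢0

cell-entry : ∀ {d} (c : Vector d) {g} (g∈ : g ∈ half d) → lookup (cell (forms d) c) (Any.index g∈) ≡ isPos (dot c ⟦ g ⟧)
cell-entry {d} c {g} g∈ = trans (lookup∘tabulate (λ i → isPos (dot c (forms d i))) (Any.index g∈))
  (cong (λ g → isPos (dot c ⟦ g ⟧)) (sym (lookup-index g∈)))

generic-half : ∀ {d} {c : Vector d} → Generic (forms d) c → ∀ {g} → g ∈ half d → dot c ⟦ g ⟧ ≢ 0ℤ
generic-half {c = c} generic g∈ = subst (λ g → dot c ⟦ g ⟧ ≢ 0ℤ) (sym (lookup-index g∈)) (generic (Any.index g∈))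

cell-signs : ∀ {d} {c c′ : Vector d} → cell (forms d) c ≡ cell (forms d) c′ →
  ∀ {g} → g ∈ half d → isPos (dot c ⟦ g ⟧) ≡ isPos (dot c′ ⟦ g ⟧)
cell-signs {c = c} {c′} same g∈ =
  trans (sym (cell-entry c g∈)) (trans (cong (λ v → lookup v (Any.index g∈)) same) (cell-entry c′ g∈))

-- A cell records signs on representatives only. If -g is the representative, "not positive" must be
-- read as "negative", which needs `c′` to be generic.
same-cell⇒same-sign : ∀ {d} {c c′ : Vector d} → Generic (forms d) c′ → cell (forms d) c ≡ cell (forms d) c′ →
  ∀ g → 0ℤ ℤ.< dot c ⟦ g ⟧ → 0ℤ ℤ.< dot c′ ⟦ g ⟧
same-cell⇒same-sign {d} {c} {c′} generic′ same g 0<cg with half-covers g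
... | inj₁ g≡0 = contradiction (sym (dot-zeroʳ c g≡0)) (ℤ.<⇒≢ 0<cg)
... | inj₂ (inj₁ g∈) = isPos⁻ (dot c′ ⟦ g ⟧) (trans (sym (cell-signs {c = c} {c′} same g∈)) (isPos⁺ (dot c ⟦ g ⟧) 0<cg))
... | inj₂ (inj₂ -g∈) = subst (0ℤ ℤ.<_) (trans (cong ℤ.-_ (dot-flip c′ g)) (ℤ.neg-involutive _))
  (neg⇒0<- (isPos-false⁻ (dot c′ ⟦ Vec.map flip g ⟧) (generic-half {c = c′} generic′ -g∈)
    (trans (sym (cell-signs {c = c} {c′} same -g∈)) (isPos-false⁺ (dot c ⟦ Vec.map flip g ⟧)
      (0<-⇒neg (subst (0ℤ ℤ.<_) (sym (trans (cong ℤ.-_ (dot-flip c g)) (ℤ.neg-involutive _))) 0<cg))))))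

-- Matroids under a linear objective

apply-set : ∀ {d n} (W : Matrix01 d n) y j r →
  apply W (y [ j ]≔ true) r ≡ apply W (y [ j ]≔ false) r + bool→ℕ (W r j)
apply-set W (b ∷ y) zero r
  rewrite Bool.∧-identityʳ (W r zero) | Bool.∧-zeroʳ (W r zero) = ℕ.+-comm (bool→ℕ (W r zero)) _
apply-set W (b ∷ y) (suc j) r =
  trans (cong (λ x → bool→ℕ (W r zero ∧ b) + x) (apply-set (λ r k → W r (suc k)) y j r)) (sym (ℕ.+-assoc (bool→ℕ (W r zero ∧ b)) _ _))

exchange : ∀ {n} → Vec Bool n → Fin n → Fin n → Vec Bool n
exchange x i j = (x [ i ]≔ false) [ j ]≔ true

set-id : ∀ {n} (x : Vec Bool n) i {b} → lookup x i ≡ b → x [ i ]≔ b ≡ x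
set-id x i refl = []≔-lookup x i

-- The columns of `i` and `j` stand on opposite sides to avoid truncated subtraction.
apply-exchange : ∀ {d n} (W : Matrix01 d n) x i j → lookup x i ≡ true → lookup x j ≡ false → ∀ r →
  apply W (exchange x i j) r + bool→ℕ (W r i) ≡ apply W x r + bool→ℕ (W r j)
apply-exchange W x i j xᵢ xⱼ r = begin
  apply W (exchange x i j) r + bool→ℕ (W r i)
    ≡⟨ cong (λ a → a + bool→ℕ (W r i)) (apply-set W (x [ i ]≔ false) j r) ⟩
  apply W ((x [ i ]≔ false) [ j ]≔ false) r + bool→ℕ (W r j) + bool→ℕ (W r i)
    ≡⟨ cong (λ y → apply W y r + bool→ℕ (W r j) + bool→ℕ (W r i)) (set-id (x [ i ]≔ false) j unset) ⟩
  apply W (x [ i ]≔ false) r + bool→ℕ (W r j) + bool→ℕ (W r i)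
    ≡⟨ swap (apply W (x [ i ]≔ false) r) (bool→ℕ (W r j)) (bool→ℕ (W r i)) ⟩
  apply W (x [ i ]≔ false) r + bool→ℕ (W r i) + bool→ℕ (W r j)
    ≡⟨ cong (λ a → a + bool→ℕ (W r j)) (apply-set W x i r) ⟨
  apply W (x [ i ]≔ true) r + bool→ℕ (W r j)
    ≡⟨ cong (λ y → apply W y r + bool→ℕ (W r j)) (set-id x i xᵢ) ⟩
  apply W x r + bool→ℕ (W r j) ∎
  where
  open ≡-Reasoning
  swap : ∀ a b c → a + b + c ≡ a + c + b
  swap = solveℕ-∀
  unset : lookup (x [ i ]≔ false) j ≡ false
  unset = trans (lookup∘update′ j≢i x false) xⱼ
    where
    j≢i : j ≢ i
    j≢i refl with () ← trans (sym xᵢ) xⱼ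

column : ∀ {d n} → Matrix01 d n → Fin n → Vector d
column W j r = + bool→ℕ (W r j)

objective-exchange : ∀ {d n} (W : Matrix01 d n) c x i j → lookup x i ≡ true → lookup x j ≡ false →
  objective c (apply W (exchange x i j)) ℤ.+ dot c (column W i) ≡ objective c (apply W x) ℤ.+ dot c (column W j)
objective-exchange W c x i j xᵢ xⱼ = begin
  objective c (apply W (exchange x i j)) ℤ.+ dot c (column W i)
    ≡⟨ dot-+ʳ c (coordinates (apply W (exchange x i j))) (column W i) ⟨
  dot c (λ r → + apply W (exchange x i j) r ℤ.+ column W i r)
    ≡⟨ dot-congʳ c (λ r → cong +_ (apply-exchange W x i j xᵢ xⱼ r)) ⟩
  dot c (λ r → + apply W x r ℤ.+ column W j r)
    ≡⟨ dot-+ʳ c (coordinates (apply W x)) (column W j) ⟩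
  objective c (apply W x) ℤ.+ dot c (column W j) ∎
  where open ≡-Reasoning

minimiser : ∀ {n} {P : Fin n → Set} → (∀ k → Dec (P k)) → (w : Fin n → ℤ) →
  (∀ k → ¬ P k) ⊎ ∃ λ i → P i × (∀ k → P k → w i ℤ.≤ w k)
minimiser {zero}  P? w = inj₁ λ ()
minimiser {suc n} {P} P? w with P? zero | minimiser (P? ∘ suc) (w ∘ suc)
... | no ¬p | inj₁ none = inj₁ λ { zero → ¬p ; (suc k) → none k }
... | no ¬p | inj₂ (i , pᵢ , least) = inj₂ (suc i , pᵢ , λ { zero p → contradiction p ¬p ; (suc k) → least k })
... | yes p | inj₁ none = inj₂ (zero , p , λ { zero _ → ℤ.≤-refl ; (suc k) q → contradiction q (none k) })
... | yes p | inj₂ (i , pᵢ , least) with w zero ℤ.≤? w (suc i)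
...   | yes w₀≤ = inj₂ (zero , p , λ { zero _ → ℤ.≤-refl ; (suc k) q → ℤ.≤-trans w₀≤ (least k q) })
...   | no  w₀≰ = inj₂ (suc i , pᵢ , λ { zero _ → ℤ.<⇒≤ (ℤ.≰⇒> w₀≰) ; (suc k) → least k })

-- The size of y ∖ x, written as the image of `y` under a one-row matrix supported off `x`, so that
-- `apply-exchange` also shows that it decreases.
excess : ∀ {n} → Vec Bool n → Vec Bool n → ℕ
excess x y = apply {1} (λ _ k → not (lookup x k)) y zero

excess-exchange : ∀ {n} (x y : Vec Bool n) i j → lookup y i ≡ true → lookup x i ≡ false →
  lookup x j ≡ true → lookup y j ≡ false → excess x (exchange y i j) < excess x y
excess-exchange x y i j yᵢ xᵢ xⱼ yⱼ = ℕ.≤-reflexive (begin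
  suc (excess x (exchange y i j))                              ≡⟨ ℕ.+-comm _ 1 ⟨
  excess x (exchange y i j) + 1                                ≡⟨ cong (λ b → excess x (exchange y i j) + bool→ℕ (not b)) xᵢ ⟨
  excess x (exchange y i j) + bool→ℕ (not (lookup x i))        ≡⟨ apply-exchange {1} (λ _ k → not (lookup x k)) y i j yᵢ yⱼ zero ⟩
  excess x y + bool→ℕ (not (lookup x j))                       ≡⟨ cong (λ b → excess x y + bool→ℕ (not b)) xⱼ ⟩
  excess x y + 0                                               ≡⟨ ℕ.+-identityʳ _ ⟩
  excess x y                                                   ∎)
  where open ≡-Reasoning

vec-ext : ∀ {n} {x y : Vec Bool n} → (∀ i → lookup x i ≡ lookup y i) → x ≡ y
vec-ext {x = x} {y} eq = trans (sym (tabulate∘lookup x)) (trans (tabulate-cong eq) (tabulate∘lookup y))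

-- Let i be a lightest element of y ∖ x.  If x ∖ y has a lighter element, exchanging it contradicts local
-- optimality; otherwise exchanging i out of y moves y towards x without decreasing its objective.
local⇒global : ∀ {d n} (S : Vec Bool n → Bool) → IsMatroid n S → (W : Matrix01 d n) (c : Vector d) →
  ∀ x → S x ≡ true →
  (∀ i j → lookup x i ≡ true → lookup x j ≡ false → S (exchange x i j) ≡ true →
    dot c (column W j) ℤ.≤ dot c (column W i)) →
  ∀ y → S y ≡ true → objective c (apply W y) ℤ.≤ objective c (apply W x)
local⇒global {n = n} S (_ , exchangeable) W c x Sx local y Sy = go y Sy (<-wellFounded (excess x y))
  where
  w : Fin n → ℤ
  w k = dot c (column W k)
  go : ∀ y → S y ≡ true → Acc _<_ (excess x y) → objective c (apply W y) ℤ.≤ objective c (apply W x)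
  go y Sy (acc rec) with minimiser (λ k → (lookup y k Bool.≟ true) ×-dec (lookup x k Bool.≟ false)) w
  -- No basis lies properly inside another: an element of x ∖ y would have to be exchanged for one
  -- of y ∖ x.
  ... | inj₁ y⊆x = ℤ.≤-reflexive (cong (objective c ∘ apply W) (vec-ext {x = y} {x} equal))
    where
    equal : ∀ k → lookup y k ≡ lookup x k
    equal k with lookup y k in yₖ | lookup x k in xₖ
    ... | true  | true  = refl
    ... | false | false = refl
    ... | true  | false = contradiction (yₖ , xₖ) (y⊆x k)
    ... | false | true  with exchangeable x y Sx Sy k xₖ yₖ
    ...   | j , yⱼ , xⱼ , _ = contradiction (yⱼ , xⱼ) (y⊆x j)
  ... | inj₂ (i , (yᵢ , xᵢ) , least)
    with any? (λ k → (lookup x k Bool.≟ true) ×-dec ((lookup y k Bool.≟ false) ×-dec (w k ℤ.<? w i)))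
  ...   | yes (k , xₖ , yₖ , wₖ<wᵢ) with exchangeable x y Sx Sy k xₖ yₖ
  ...     | j , yⱼ , xⱼ , S′ = contradiction (ℤ.≤-<-trans (local k j xₖ xⱼ S′) wₖ<wᵢ) (ℤ.≤⇒≯ (least j (yⱼ , xⱼ)))
  go y Sy (acc rec) | inj₂ (i , (yᵢ , xᵢ) , least) | no none with exchangeable y x Sy Sx i yᵢ xᵢ
  ...     | j , xⱼ , yⱼ , S′ = ℤ.≤-trans improves
              (go (exchange y i j) S′ (rec (excess-exchange x y i j yᵢ xᵢ xⱼ yⱼ)))
    where
    wᵢ≤wⱼ : w i ℤ.≤ w j
    wᵢ≤wⱼ = ℤ.≮⇒≥ λ wⱼ<wᵢ → none (j , xⱼ , yⱼ , wⱼ<wᵢ)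
    improves : objective c (apply W y) ℤ.≤ objective c (apply W (exchange y i j))
    improves = ℤ.≮⇒≥ λ worse → ℤ.<-irrefl (objective-exchange W c y i j yᵢ yⱼ)
      (ℤ.<-≤-trans (ℤ.+-monoˡ-< (w i) worse) (ℤ.+-monoʳ-≤ (objective c (apply W y)) wᵢ≤wⱼ))

-- From vertices to cells

_≐?_ : ∀ {d} (p q : Point d) → Dec (p ≐ q)
p ≐? q = all? (λ i → p i ℕ.≟ q i)

-- Uniqueness is asked of the image point only: several bases may project to `p`.
Exposes : ∀ {d n} → Matrix01 d n → (Vec Bool n → Bool) → Vector d → Point d → Set
Exposes W S c p = ∀ x → S x ≡ true → (apply W x ≐ p) ⊎ objective c (apply W x) ℤ.< objective c p

bits : ∀ n → List (Vec Bool n)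
bits zero    = [] ∷ []
bits (suc n) = map (true ∷_) (bits n) ++ map (false ∷_) (bits n)

∈-bits : ∀ {n} (x : Vec Bool n) → x ∈ bits n
∈-bits [] = here refl
∈-bits {suc n} (true  ∷ x) = ∈-++⁺ˡ (∈-map⁺ (true ∷_) (∈-bits x))
∈-bits {suc n} (false ∷ x) = ∈-++⁺ʳ (map (true ∷_) (bits n)) (∈-map⁺ (false ∷_) (∈-bits x))

-- Gordan's alternative for the differences p - Wx over the bases with Wx ≠ p. A vanishing sum of
-- them would put `p` in the hull of the other image points; a functional positive on all of them
-- exposes `p`, and still does after a generic perturbation.
vertex⇒exposed : ∀ {d n} (W : Matrix01 d n) S p → IsVertex W S p → ∃ λ c → Generic (forms d) c × Exposes W S c p
vertex⇒exposed {d} {n} W S p (_ , ∉hull) = separate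
  (gordan Cone cone-resp cone-add (length us) us refl (All.map⁺ (All.map generator (All.all-filter Other? (bits n)))))
  where
  Others : Point d → Set
  Others q = InImage W S q × ¬ (q ≐ p)
  Other : Vec Bool n → Set
  Other x = S x ≡ true × ¬ (apply W x ≐ p)
  Other? : ∀ x → Dec (Other x)
  Other? x = (S x Bool.≟ true) ×-dec ¬? (apply W x ≐? p)
  gap : Vec Bool n → Vector d
  gap x i = + p i ℤ.- + apply W x i
  us : List (Vector d)
  us = map gap (filter Other? (bits n))
  -- Lists are nonempty by construction: the empty sum is zero without giving a convex combination.
  Cone : Vector d → Set
  Cone v = ∃ λ q → ∃ λ qs → All Others (q ∷ qs) × v ≗ gaps p (q ∷ qs)
  cone-resp : ∀ {u v} → u ≗ v → Cone u → Cone v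
  cone-resp u≗v (q , qs , all , eq) = q , qs , all , λ i → trans (sym (u≗v i)) (eq i)
  cone-add : ∀ {u v} → Cone u → Cone v → Cone (λ i → u i ℤ.+ v i)
  cone-add (q , qs , all , eq) (r , rs , all′ , eq′) = q , qs ++ r ∷ rs , All.++⁺ all all′ ,
    λ i → trans (cong₂ ℤ._+_ (eq i) (eq′ i)) (sym (gaps-++ p (q ∷ qs) (r ∷ rs) i))
  generator : ∀ {x} → Other x → Cone (gap x)
  generator {x} (Sx , ≢p) = apply W x , [] , ((x , Sx , λ _ → refl) , ≢p) ∷ [] , λ i → sym (ℤ.+-identityʳ _)
  separate : (∃ λ c → All (λ u → 0ℤ ℤ.< dot c u) us) ⊎ (∃ λ v → Cone v × IsZero v) →
             ∃ λ c → Generic (forms d) c × Exposes W S c p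
  separate (inj₂ (v , (q , qs , all , eq) , v≡0)) =
    contradiction (zero-gaps⇒∈hull Others p q qs all (λ i → trans (sym (eq i)) (v≡0 i))) ∉hull
  separate (inj₁ (c , positive)) with genericise us c
  ... | c′ , preserved , generic = c′ , generic , exposes
    where
    exposes : Exposes W S c′ p
    exposes x Sx with apply W x ≐? p
    ... | yes ≐p = inj₁ ≐p
    ... | no ≢p = inj₂ (0<j-i⇒i<j (subst (0ℤ ℤ.<_) (dot-−ʳ c′ (coordinates p) (coordinates (apply W x)))
                    (All.lookup preserved gap∈ (All.lookup positive gap∈))))
      where
      gap∈ : gap x ∈ us
      gap∈ = ∈-map⁺ gap (∈-filter⁺ Other? (∈-bits x) (Sx , ≢p))

difference : Bool → Bool → Trit
difference true  true  = ⊙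
difference true  false = ⊕
difference false true  = ⊖
difference false false = ⊙

value-difference : ∀ a b → value (difference a b) ≡ + bool→ℕ a ℤ.- + bool→ℕ b
value-difference true  true  = refl
value-difference true  false = refl
value-difference false true  = refl
value-difference false false = refl

columnDifference : ∀ {d n} → Matrix01 d n → Fin n → Fin n → Vec Trit d
columnDifference W j i = tabulate (λ r → difference (W r j) (W r i))

dot-columnDifference : ∀ {d n} (W : Matrix01 d n) c j i →
  dot c ⟦ columnDifference W j i ⟧ ≡ dot c (column W j) ℤ.- dot c (column W i)
dot-columnDifference W c j i = trans (dot-congʳ c entry) (dot-−ʳ c (column W j) (column W i))
  where
  entry : ∀ r → ⟦ columnDifference W j i ⟧ r ≡ column W j r ℤ.- column W i r
  entry r = trans (cong value (lookup∘tabulate (λ r → difference (W r j) (W r i)) r)) (value-difference (W r j) (W r i))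

-- Differences of image points need not be ternary, so a cell does not compare two bases directly.
-- It does compare columns: an exchange that gains for `c′` gains for `c`. Hence `x`, optimal for
-- `c`, is locally and therefore globally optimal for `c′`, whose only optimal point is `p′`.
same-cell⇒same-vertex : ∀ {d n} (W : Matrix01 d n) S → IsMatroid n S → ∀ {c c′ p p′} →
  InImage W S p → InImage W S p′ → Generic (forms d) c → Exposes W S c p → Exposes W S c′ p′ →
  cell (forms d) c ≡ cell (forms d) c′ → p ≐ p′
same-cell⇒same-vertex {d} W S matroid {c} {c′} {p} {p′} (x , Sx , Wx≐p) (x′ , Sx′ , Wx′≐p′) generic exposes exposes′ same
  with exposes′ x Sx
... | inj₁ Wx≐p′ = λ i → trans (sym (Wx≐p i)) (Wx≐p′ i)
... | inj₂ worse = contradiction worse (ℤ.≤⇒≯ (subst (ℤ._≤ objective c′ (apply W x)) (objective-cong c′ Wx′≐p′)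
                     (local⇒global S matroid W c′ x Sx local x′ Sx′)))
  where
  maximal : ∀ y → S y ≡ true → objective c (apply W y) ℤ.≤ objective c (apply W x)
  maximal y Sy with exposes y Sy
  ... | inj₁ Wy≐p = ℤ.≤-reflexive (objective-cong c (λ i → trans (Wy≐p i) (sym (Wx≐p i))))
  ... | inj₂ less = subst (objective c (apply W y) ℤ.≤_) (sym (objective-cong c Wx≐p)) (ℤ.<⇒≤ less)
  local : ∀ i j → lookup x i ≡ true → lookup x j ≡ false → S (exchange x i j) ≡ true →
    dot c′ (column W j) ℤ.≤ dot c′ (column W i)
  local i j xᵢ xⱼ S-exchange = ℤ.≮⇒≥ λ gain′ →
    let g = columnDifference W j i
        gain : dot c (column W i) ℤ.< dot c (column W j)
        gain = 0<j-i⇒i<j (subst (0ℤ ℤ.<_) (dot-columnDifference W c j i)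
                 (same-cell⇒same-sign {c = c′} {c} generic (sym same) g
                   (subst (0ℤ ℤ.<_) (sym (dot-columnDifference W c′ j i)) (i<j⇒0<j-i gain′))))
    in ℤ.<-irrefl (objective-exchange W c x i j xᵢ xⱼ)
         (ℤ.≤-<-trans (ℤ.+-monoˡ-≤ (dot c (column W i)) (maximal (exchange x i j) S-exchange))
                      (ℤ.+-monoʳ-< (objective c (apply W x)) gain))

attach : ∀ {A : Set} {P : A → Set} {xs} → All P xs → ∃ λ (ts : List (∃ P)) → map proj₁ ts ≡ xs
attach []         = [] , refl
attach (px ∷ pxs) = let ts , eq = attach pxs in (_ , px) ∷ ts , cong (_ ∷_) eq

cells-bound-half : ∀ d → 1 ≤ d → (cs : List (Vector d)) → All (Generic (forms d)) cs →
  AllPairs (λ c c′ → cell (forms d) c ≢ cell (forms d) c′) cs → length cs ≤ upperBound d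
cells-bound-half d 1≤d = resize (length-half-pred d 1≤d) (forms d)
  where
  -- The number of forms is a successor only propositionally; it becomes a variable so that the
  -- equation can be matched.
  resize : ∀ {n m} → n ≡ suc m → (h : Fin n → Vector d) (cs : List (Vector d)) → All (Generic h) cs →
    AllPairs (λ c c′ → cell h c ≢ cell h c′) cs → length cs ≤ 2 * binomialSum m d
  resize refl = cells-bound

vertices≤upperBound : ∀ d → 1 ≤ d → MaxAtMost d (upperBound d)
vertices≤upperBound d 1≤d n S W matroid vs vertices distinct with attach vertices
... | ts , refl = subst (_≤ upperBound d) (trans (length-map normal ts) (sym (length-map proj₁ ts)))
  (cells-bound-half d 1≤d (map normal ts)
    (All.map⁺ (All.universal (λ (p , vertex) → proj₁ (proj₂ (vertex⇒exposed W S p vertex))) ts))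
    (AllPairs.map⁺ (AllPairs.map separate (AllPairs.map⁻ distinct))))
  where
  normal : ∃ (IsVertex W S) → Vector d
  normal (p , vertex) = proj₁ (vertex⇒exposed W S p vertex)
  separate : ∀ {s t} → Distinct (proj₁ s) (proj₁ t) → cell (forms d) (normal s) ≢ cell (forms d) (normal t)
  separate {p , vertex} {p′ , vertex′} p≢p′ same with vertex⇒exposed W S p vertex | vertex⇒exposed W S p′ vertex′
  ... | c , generic , exposes | c′ , generic′ , exposes′ =
    p≢p′ (same-cell⇒same-vertex W S matroid {c} {c′} (proj₁ vertex) (proj₁ vertex′) generic exposes exposes′ same)

-- The zonotope of all ternary directions

-- Unlike `2 * k`, this unfolds two constructors at a time, so vectors can be matched block by
-- block.
double : ℕ → ℕ
double zero    = zero
double (suc k) = suc (suc (double k))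

transversal : ∀ k → Vec Bool (double k) → Bool
transversal zero    []          = true
transversal (suc k) (a ∷ b ∷ x) = (a xor b) ∧ transversal k x

-- The exchange stays within the block of `i`: if B₂ lacks `i`, it contains the other element of
-- that block.
transversal-matroid : ∀ k → IsMatroid (double k) (transversal k)
transversal-matroid k = some k , exchangeable k
  where
  some : ∀ k → ∃ λ B → transversal k B ≡ true
  some zero    = [] , refl
  some (suc k) = let B , B∈ = some k in true ∷ false ∷ B , B∈
  exchangeable : ∀ k B₁ B₂ → transversal k B₁ ≡ true → transversal k B₂ ≡ true →
    ∀ i → lookup B₁ i ≡ true → lookup B₂ i ≡ false →
    ∃ λ j → lookup B₂ j ≡ true × lookup B₁ j ≡ false × transversal k (exchange B₁ i j) ≡ true
  exchangeable (suc k) (true ∷ false ∷ B₁) (false ∷ true ∷ B₂) B₁∈ _ zero _ _ = suc zero , refl , refl , B₁∈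
  exchangeable (suc k) (false ∷ true ∷ B₁) (true ∷ false ∷ B₂) B₁∈ _ (suc zero) _ _ = zero , refl , refl , B₁∈
  exchangeable (suc k) (false ∷ true ∷ B₁) (false ∷ true ∷ B₂) _ _ (suc zero) _ ()
  exchangeable (suc k) (false ∷ true ∷ B₁) (false ∷ false ∷ B₂) _ () (suc zero) _ _
  exchangeable (suc k) (a ∷ b ∷ B₁) (a′ ∷ b′ ∷ B₂) B₁∈ B₂∈ (suc (suc i)) B₁ᵢ B₂ᵢ
    with exchangeable k B₁ B₂ (Bool.∧-conicalʳ (a xor b) _ B₁∈) (Bool.∧-conicalʳ (a′ xor b′) _ B₂∈) i B₁ᵢ B₂ᵢ
  ... | j , B₂ⱼ , B₁ⱼ , B∈ = suc (suc j) , B₂ⱼ , B₁ⱼ , cong₂ _∧_ (Bool.∧-conicalˡ (a xor b) _ B₁∈) B∈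

isPlus isMinus : Trit → Bool
isPlus ⊕ = true
isPlus _ = false
isMinus ⊖ = true
isMinus _ = false

-- The positive and negative parts of `g`. The segment between them is a translate of [0, g] with
-- 0/1 endpoints, so both can serve as columns of the matrix.
endpoint : ∀ {d} → Vec Trit d → Bool → Vector d
endpoint g true  r = + bool→ℕ (isPlus (lookup g r))
endpoint g false r = + bool→ℕ (isMinus (lookup g r))

segmentSum : ∀ {d} (gs : List (Vec Trit d)) → Matrix01 d (double (length gs))
segmentSum (g ∷ gs) r zero          = isPlus (lookup g r)
segmentSum (g ∷ gs) r (suc zero)    = isMinus (lookup g r)
segmentSum (g ∷ gs) r (suc (suc j)) = segmentSum gs r j

dot-endpoints : ∀ {d} (c : Vector d) g → dot c (endpoint g true) ℤ.- dot c (endpoint g false) ≡ dot c ⟦ g ⟧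
dot-endpoints c g = trans (sym (dot-−ʳ c (endpoint g true) (endpoint g false))) (dot-congʳ c (λ r → split (lookup g r)))
  where
  split : ∀ t → + bool→ℕ (isPlus t) ℤ.- + bool→ℕ (isMinus t) ≡ value t
  split ⊖ = refl
  split ⊙ = refl
  split ⊕ = refl

segmentSum-objective : ∀ {d} (c : Vector d) g gs a x →
  objective c (apply (segmentSum (g ∷ gs)) (a ∷ not a ∷ x)) ≡ dot c (endpoint g a) ℤ.+ objective c (apply (segmentSum gs) x)
segmentSum-objective c g gs a x = trans (dot-congʳ c (λ r → entry a r))
  (dot-+ʳ c (endpoint g a) (coordinates (apply (segmentSum gs) x)))
  where
  entry : ∀ a r → + apply (segmentSum (g ∷ gs)) (a ∷ not a ∷ x) r ≡ endpoint g a r ℤ.+ + apply (segmentSum gs) x r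
  entry true r rewrite Bool.∧-identityʳ (isPlus (lookup g r)) | Bool.∧-zeroʳ (isMinus (lookup g r)) = refl
  entry false r rewrite Bool.∧-identityʳ (isMinus (lookup g r)) | Bool.∧-zeroʳ (isPlus (lookup g r)) = refl

choose : ∀ {d} → Vector d → (gs : List (Vec Trit d)) → Vec Bool (double (length gs))
choose c []       = []
choose c (g ∷ gs) = isPos (dot c ⟦ g ⟧) ∷ not (isPos (dot c ⟦ g ⟧)) ∷ choose c gs

choose∈transversal : ∀ {d} (c : Vector d) gs → transversal (length gs) (choose c gs) ≡ true
choose∈transversal c []       = refl
choose∈transversal c (g ∷ gs) with isPos (dot c ⟦ g ⟧)
... | true  = choose∈transversal c gs
... | false = choose∈transversal c gs

choose-injective : ∀ {d} (c c′ : Vector d) gs → choose c gs ≡ choose c′ gs →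
  ∀ {g} → g ∈ gs → isPos (dot c ⟦ g ⟧) ≡ isPos (dot c′ ⟦ g ⟧)
choose-injective c c′ (_ ∷ gs) eq (here refl) = ∷-injectiveˡ eq
choose-injective c c′ (_ ∷ gs) eq (there g∈)  = choose-injective c c′ gs (∷-injectiveʳ (∷-injectiveʳ eq)) g∈

endpoint-maximal : ∀ {d} (c : Vector d) g → dot c ⟦ g ⟧ ≢ 0ℤ → ∀ a →
  a ≡ isPos (dot c ⟦ g ⟧) ⊎ dot c (endpoint g a) ℤ.< dot c (endpoint g (isPos (dot c ⟦ g ⟧)))
endpoint-maximal c g cg≢0 a with isPos (dot c ⟦ g ⟧) in sign | a
... | true  | true  = inj₁ refl
... | false | false = inj₁ refl
... | true  | false = inj₂ (0<j-i⇒i<j (subst (0ℤ ℤ.<_) (sym (dot-endpoints c g)) (isPos⁻ (dot c ⟦ g ⟧) sign)))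
... | false | true  = inj₂ (0<j-i⇒i<j (subst (0ℤ ℤ.<_)
  (trans (cong ℤ.-_ (sym (dot-endpoints c g))) (negate (dot c (endpoint g true)) (dot c (endpoint g false))))
  (neg⇒0<- (isPos-false⁻ (dot c ⟦ g ⟧) cg≢0 sign))))
  where
  negate : ∀ x y → ℤ.- (x ℤ.- y) ≡ y ℤ.- x
  negate = solve-∀

-- The objective is a sum over blocks, so each block is maximised separately; genericity excludes
-- ties.
choose-maximal : ∀ {d} (c : Vector d) gs → All (λ g → dot c ⟦ g ⟧ ≢ 0ℤ) gs →
  ∀ x → transversal (length gs) x ≡ true →
  x ≡ choose c gs ⊎ objective c (apply (segmentSum gs) x) ℤ.< objective c (apply (segmentSum gs) (choose c gs))
choose-maximal c [] [] [] _ = inj₁ refl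
choose-maximal c (g ∷ gs) (cg≢0 ∷ generic) (a ∷ b ∷ x) ab∈
  with complement a b (Bool.∧-conicalˡ (a xor b) _ ab∈)
  where
  complement : ∀ a b → a xor b ≡ true → b ≡ not a
  complement true  false _ = refl
  complement false true  _ = refl
... | refl with endpoint-maximal c g cg≢0 a | choose-maximal c gs generic x (Bool.∧-conicalʳ (a xor b) _ ab∈)
...   | inj₁ refl | inj₁ refl = inj₁ refl
...   | inj₁ refl | inj₂ less = inj₂ (subst₂ ℤ._<_ (sym (segmentSum-objective c g gs a x))
                                  (sym (segmentSum-objective c g gs _ (choose c gs)))
                                  (ℤ.+-monoʳ-< (dot c (endpoint g a)) less))
...   | inj₂ less | inj₁ refl = inj₂ (subst₂ ℤ._<_ (sym (segmentSum-objective c g gs a x))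
                                  (sym (segmentSum-objective c g gs _ (choose c gs)))
                                  (ℤ.+-monoˡ-< (objective c (apply (segmentSum gs) x)) less))
...   | inj₂ less | inj₂ less′ = inj₂ (subst₂ ℤ._<_ (sym (segmentSum-objective c g gs a x))
                                  (sym (segmentSum-objective c g gs _ (choose c gs)))
                                  (ℤ.+-mono-< less less′))

zonotope : ∀ d → Matrix01 d (double (length (half d)))
zonotope d = segmentSum (half d)

selections : ∀ d → Vec Bool (double (length (half d))) → Bool
selections d = transversal (length (half d))

corner : ∀ {d} → Vector d → Point d
corner {d} c = apply (zonotope d) (choose c (half d))

corner-maximal : ∀ {d} {c : Vector d} → Generic (forms d) c → ∀ x → selections d x ≡ true →
  x ≡ choose c (half d) ⊎ objective c (apply (zonotope d) x) ℤ.< objective c (corner c)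
corner-maximal {d} {c} generic = choose-maximal c (half d) (All.tabulate (generic-half {c = c} generic))

corner-vertex : ∀ {d} {c : Vector d} → Generic (forms d) c → IsVertex (zonotope d) (selections d) (corner c)
corner-vertex {d} {c} generic = (choose c (half d) , choose∈transversal c (half d) , λ _ → refl) ,
  separated⇒∉hull c (corner c) _ below
  where
  below : ∀ q → InImage (zonotope d) (selections d) q × ¬ (q ≐ corner c) → objective c q ℤ.< objective c (corner c)
  below q ((x , x∈ , Wx≐q) , q≢) with corner-maximal {c = c} generic x x∈
  ... | inj₁ refl = contradiction (λ i → sym (Wx≐q i)) q≢
  ... | inj₂ less = subst (ℤ._< objective c (corner c)) (objective-cong c Wx≐q) less

-- If the corners coincide, the selection for `c′` attains the maximum of `c`, which only the
-- selection for `c` attains. Equal selections record equal signs.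
corner-injective : ∀ {d} {c c′ : Vector d} → Generic (forms d) c → corner c ≐ corner c′ →
  cell (forms d) c ≡ cell (forms d) c′
corner-injective {d} {c} {c′} generic same with corner-maximal {c = c} generic (choose c′ (half d)) (choose∈transversal c′ (half d))
... | inj₁ eq   = tabulate-cong λ i → choose-injective c c′ (half d) (sym eq) (∈-lookup i)
... | inj₂ less = contradiction (sym (objective-cong c same)) (ℤ.<⇒≢ less)

-- Functionals labelled by an orthant and a dominant coordinate

dot-set : ∀ {d} (c : Vector d) (g : Vec Trit d) k t → lookup g k ≡ ⊙ →
  dot c ⟦ g [ k ]≔ t ⟧ ≡ dot c ⟦ g ⟧ ℤ.+ c k ℤ.* value t
dot-set c (⊙ ∷ g) zero t refl = rearrange (c zero) (value t) (dot (c ∘ suc) ⟦ g ⟧)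
  where
  rearrange : ∀ a t x → a ℤ.* t ℤ.+ x ≡ a ℤ.* 0ℤ ℤ.+ x ℤ.+ a ℤ.* t
  rearrange = solve-∀
dot-set c (s ∷ g) (suc k) t gₖ = trans (cong (λ x → c zero ℤ.* value s ℤ.+ x) (dot-set (c ∘ suc) g k t gₖ))
  (sym (ℤ.+-assoc (c zero ℤ.* value s) (dot (c ∘ suc) ⟦ g ⟧) (c (suc k) ℤ.* value t)))

single : ∀ {d} → Fin d → Trit → Vec Trit d
single k t = replicate _ ⊙ [ k ]≔ t

dot-single : ∀ {d} (c : Vector d) k t → dot c ⟦ single k t ⟧ ≡ c k ℤ.* value t
dot-single c k t = trans (dot-set c (replicate _ ⊙) k t (lookup-replicate k ⊙))
  (trans (cong (ℤ._+ c k ℤ.* value t) (dot-zeroʳ c (λ i → cong value (lookup-replicate i ⊙)))) (ℤ.+-identityˡ _))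

sgn : Bool → Trit
sgn true  = ⊕
sgn false = ⊖

sgn-not : ∀ b → sgn (not b) ≡ flip (sgn b)
sgn-not true  = refl
sgn-not false = refl

scaleAt : ∀ {d} → Fin d → Fin d → ℤ
scaleAt k i = if does (k ≟ i) then + 2 else 1ℤ

scaleAt-pos : ∀ {d} (k i : Fin d) → 0ℤ ℤ.< scaleAt k i
scaleAt-pos k i with does (k ≟ i)
... | true  = ℤ.+<+ (s≤s z≤n)
... | false = ℤ.+<+ (s≤s z≤n)

scaleAt-same : ∀ {d} (k : Fin d) → scaleAt k k ≡ + 2
scaleAt-same k = cong (if_then + 2 else 1ℤ) (dec-true (k ≟ k) refl)

scaleAt-other : ∀ {d} {k i : Fin d} → k ≢ i → scaleAt k i ≡ 1ℤ
scaleAt-other {k = k} {i} k≢i = cong (if_then + 2 else 1ℤ) (dec-false (k ≟ i) k≢i)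

-- The signs `s` fix the orthant, and the entry of size 2 among entries of size 1 marks the dominant
-- coordinate `k`. For d ≥ 3 it is not generic: a ternary vector cancels two entries of size 1.
direction : ∀ {d} → Fin d × Vec Bool d → Vector d
direction (k , s) i = value (sgn (lookup s i)) ℤ.* scaleAt k i

direction-aligned : ∀ {d} (k : Fin d) s i → direction (k , s) i ℤ.* value (sgn (lookup s i)) ≡ scaleAt k i
direction-aligned k s i with lookup s i
... | true  = plus (scaleAt k i)
  where
  plus : ∀ x → 1ℤ ℤ.* x ℤ.* 1ℤ ≡ x
  plus = solve-∀
... | false = minus (scaleAt k i)
  where
  minus : ∀ x → ℤ.- 1ℤ ℤ.* x ℤ.* ℤ.- 1ℤ ≡ x
  minus = solve-∀

direction-opposed : ∀ {d} (k : Fin d) s i → direction (k , s) i ℤ.* value (flip (sgn (lookup s i))) ≡ ℤ.- scaleAt k i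
direction-opposed k s i = trans (cong (direction (k , s) i ℤ.*_) (value-flip (sgn (lookup s i))))
  (trans (sym (ℤ.neg-distribʳ-* (direction (k , s) i) (value (sgn (lookup s i))))) (cong ℤ.-_ (direction-aligned k s i)))

-- Positive on direction (k , s), negative on direction (l , s).
contrast : ∀ {d} → Vec Bool d → Fin d → Fin d → Vec Trit d
contrast s k l = single k (sgn (lookup s k)) [ l ]≔ flip (sgn (lookup s l))

dot-contrast : ∀ {d} (m : Fin d) s {k l} → k ≢ l →
  dot (direction (m , s)) ⟦ contrast s k l ⟧ ≡ scaleAt m k ℤ.- scaleAt m l
dot-contrast m s {k} {l} k≢l = trans
  (dot-set (direction (m , s)) (single k (sgn (lookup s k))) l (flip (sgn (lookup s l)))
    (trans (lookup∘update′ (k≢l ∘ sym) (replicate _ ⊙) (sgn (lookup s k))) (lookup-replicate l ⊙)))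
  (cong₂ ℤ._+_ (trans (dot-single (direction (m , s)) k (sgn (lookup s k))) (direction-aligned m s k))
               (direction-opposed m s l))

-- All ternary vectors are listed as signs to be kept, so those that tell labels apart survive the
-- perturbation.
normal : ∀ {d} → Fin d × Vec Bool d → Vector d
normal {d} ks = proj₁ (genericise (map ⟦_⟧ (trits d)) (direction ks))

normal-generic : ∀ {d} (ks : Fin d × Vec Bool d) → Generic (forms d) (normal ks)
normal-generic {d} ks = proj₂ (proj₂ (genericise (map ⟦_⟧ (trits d)) (direction ks)))

normal-sign : ∀ {d} (ks : Fin d × Vec Bool d) g → 0ℤ ℤ.< dot (direction ks) ⟦ g ⟧ → 0ℤ ℤ.< dot (normal ks) ⟦ g ⟧
normal-sign {d} ks g = All.lookup (proj₁ (proj₂ (genericise (map ⟦_⟧ (trits d)) (direction ks)))) (∈-map⁺ ⟦_⟧ (∈-trits g))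

normal-cells-differ : ∀ {d} (ks ls : Fin d × Vec Bool d) g →
  0ℤ ℤ.< dot (direction ks) ⟦ g ⟧ → dot (direction ls) ⟦ g ⟧ ℤ.< 0ℤ →
  cell (forms d) (normal ks) ≢ cell (forms d) (normal ls)
normal-cells-differ ks ls g positive negative same = ℤ.<-asym
  (same-cell⇒same-sign {c = normal ks} {normal ls} (normal-generic ls) same g (normal-sign ks g positive))
  (0<-⇒neg (subst (0ℤ ℤ.<_) (dot-flip (normal ls) g)
    (normal-sign ls (Vec.map flip g) (subst (0ℤ ℤ.<_) (sym (dot-flip (direction ls) g)) (neg⇒0<- negative)))))

-- Different orthants are told apart by a signed unit vector. In the same orthant, `contrast s k l`
-- takes the values 2 - 1 and 1 - 2.
normal-cell-injective : ∀ {d} (ks ls : Fin d × Vec Bool d) →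
  cell (forms d) (normal ks) ≡ cell (forms d) (normal ls) → ks ≡ ls
normal-cell-injective (k , s) (l , t) same with vec-ext {x = s} {t} same-signs
  where
  same-signs : ∀ i → lookup s i ≡ lookup t i
  same-signs i with lookup s i Bool.≟ lookup t i
  ... | yes eq = eq
  ... | no neq = contradiction same (normal-cells-differ (k , s) (l , t) (single i (sgn (lookup s i)))
    (subst (0ℤ ℤ.<_) (sym (trans (dot-single (direction (k , s)) i (sgn (lookup s i))) (direction-aligned k s i))) (scaleAt-pos k i))
    (subst (ℤ._< 0ℤ) (sym (trans (dot-single (direction (l , t)) i (sgn (lookup s i)))
      (trans (cong (λ u → direction (l , t) i ℤ.* value u) (trans (cong sgn (Bool.¬-not neq)) (sgn-not (lookup t i))))
        (direction-opposed l t i)))) (ℤ.neg-mono-< (scaleAt-pos l i))))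
... | refl with k ≟ l
...   | yes refl = refl
...   | no k≢l = contradiction same (normal-cells-differ (k , s) (l , s) (contrast s k l)
    (subst (0ℤ ℤ.<_) (sym (trans (dot-contrast k s k≢l) (cong₂ ℤ._-_ (scaleAt-same k) (scaleAt-other k≢l)))) (ℤ.+<+ (s≤s z≤n)))
    (subst (ℤ._< 0ℤ) (sym (trans (dot-contrast l s k≢l) (cong₂ ℤ._-_ (scaleAt-other (k≢l ∘ sym)) (scaleAt-same l)))) ℤ.-<+))

-- Counting the labels, and the theorem

length-bits : ∀ n → length (bits n) ≡ 2 ^ n
length-bits zero    = refl
length-bits (suc n) = trans (length-++ (map (true ∷_) (bits n))) (cong₂ _+_ (len true) (trans (len false) (sym (ℕ.+-identityʳ _))))
  where
  len : ∀ b → length (map (b ∷_) (bits n)) ≡ 2 ^ n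
  len b = trans (length-map (b ∷_) (bits n)) (length-bits n)

bits-unique : ∀ n → Unique (bits n)
bits-unique zero    = [] ∷ []
bits-unique (suc n) = Unique.++⁺ (Unique.map⁺ ∷-injectiveʳ (bits-unique n)) (Unique.map⁺ ∷-injectiveʳ (bits-unique n)) disjoint
  where
  disjoint : ∀ {v} → ¬ (v ∈ map (true ∷_) (bits n) × v ∈ map (false ∷_) (bits n))
  disjoint (v∈₁ , v∈₀) with ∈-map⁻ (true ∷_) v∈₁ | ∈-map⁻ (false ∷_) v∈₀
  ... | _ , _ , refl | _ , _ , ()

length-cartesianProduct : ∀ {A B : Set} (xs : List A) (ys : List B) →
  length (cartesianProduct xs ys) ≡ length xs * length ys
length-cartesianProduct []       ys = refl
length-cartesianProduct (x ∷ xs) ys = trans (length-++ (map (x ,_) ys))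
  (cong₂ _+_ (length-map (x ,_) ys) (length-cartesianProduct xs ys))

manyVertices : ∀ d → MaxAtLeast d (d * 2 ^ d)
manyVertices d = _ , selections d , zonotope d , transversal-matroid (length (half d)) ,
  map (corner ∘ normal) labels , count-labels ,
  All.map⁺ (All.universal (λ ks → corner-vertex {c = normal ks} (normal-generic ks)) labels) ,
  AllPairs.map⁺ (AllPairs.map (λ {ks} {ls} ks≢ls same → ks≢ls (normal-cell-injective ks ls
    (corner-injective {c = normal ks} {normal ls} (normal-generic ks) same)))
    (Unique.cartesianProduct⁺ (Unique.allFin⁺ d) (bits-unique d)))
  where
  labels : List (Fin d × Vec Bool d)
  labels = cartesianProduct (allFin d) (bits d)
  count-labels : length (map (corner ∘ normal) labels) ≡ d * 2 ^ d
  count-labels = trans (length-map (corner ∘ normal) labels) (trans (length-cartesianProduct (allFin d) (bits d))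
    (cong₂ _*_ (length-tabulate {n = d} id) (length-bits d)))

-- With m + 1 forms, m + 1 ≤ 3^d, the sum of degree d - 1 is at most (3^d)^(d-1); the constant 2 is
-- the factor already present in `upperBound`.
upperBound-growth : ∀ d → 1 ≤ d → upperBound d ≤ 2 * 3 ^ (d * (d ∸ 1))
upperBound-growth d@(suc e) 1≤d = ℕ.*-monoʳ-≤ 2 (begin
  binomialSum m (suc e)   ≤⟨ binomialSum-≤ m e ⟩
  suc m ^ e               ≡⟨ cong (_^ e) (length-half-pred d 1≤d) ⟨
  length (half d) ^ e     ≤⟨ ℕ.^-monoˡ-≤ e half≤3^d ⟩
  (3 ^ d) ^ e             ≡⟨ ℕ.^-*-assoc 3 d e ⟩
  3 ^ (d * e)             ∎)
  where
  open ℕ.≤-Reasoning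
  m : ℕ
  m = (3 ^ d ∸ 3) Data.Nat./ 2
  half≤3^d : length (half d) ≤ 3 ^ d
  half≤3^d = ℕ.≤-trans (ℕ.≤-trans (ℕ.m≤m+n _ _) (ℕ.n≤1+n _)) (ℕ.≤-reflexive (length-half d))

theorem4p6 : (∀ d → 1 ≤ d → MaxAtLeast d (d * 2 ^ d) × MaxAtMost d (upperBound d)) ×
    (∃ λ C → ∀ d → 1 ≤ d → upperBound d ≤ C * 3 ^ (d * (d ∸ 1))) ×
    (∀ d → 1 ≤ d → d ≤ 2 → d * 2 ^ d ≡ upperBound d) ×
    (MaxAtLeast 1 2 × MaxAtMost 1 2) ×
    (MaxAtLeast 2 8 × MaxAtMost 2 8)
theorem4p6 =
  (λ d 1≤d → manyVertices d , vertices≤upperBound d 1≤d) ,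
  (2 , upperBound-growth) ,
  coincide ,
  (manyVertices 1 , vertices≤upperBound 1 (s≤s z≤n)) ,
  (manyVertices 2 , vertices≤upperBound 2 (s≤s z≤n))
  where
  coincide : ∀ d → 1 ≤ d → d ≤ 2 → d * 2 ^ d ≡ upperBound d
  -- Both sides compute: 2 for d = 1, and 8 = 2 (1 + 3) for d = 2. The same computation turns the
  -- general bounds into the stated values of m(1) and m(2).
  coincide 1 _ _ = refl
  coincide 2 _ _ = refl
  coincide (suc (suc (suc _))) _ (s≤s (s≤s ()))
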